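{- Let $(H,\Lambda)$ be a signified graph on exactly $9$ vertices such that every signified graph whose underlying graph is outerplanar admits a signified homomorphism to $(H,\Lambda)$. Then $(H,\Lambda)$ is isomorphic (by a sign-preserving isomorphism) to $SP_9$.
   Context: A signified graph $(G,\Sigma)$ is a simple graph $G$ with a set $\Sigma\subseteq E(G)$ of negative edges, other edges positive. A signified homomorphism of $(G,\Sigma)$ to $(H,\Lambda)$ is a map $V(G)\to V(H)$ sending every edge to an edge of the same sign. $SP_9$ is the complete graph on vertex set $\mathbb{F}_9$ where the edge $xy$ is negative iff $y-x$ is a non-square in $\mathbb{F}_9$. -}

module Defs where

open import Algebra.Structures using (IsCommutativeRing)
open import Data.Fin.Base using (Fin; zero; suc; toℕ)
open import Data.Fin.Properties as Fin using (*↔×)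
open import Data.List.Base using (List; []; _∷_; _∷ʳ_; reverse)
open import Data.Nat.Base as ℕ using (ℕ)
open import Data.Nat.DivMod using (_mod_)
open import Data.Product.Base using (Σ-syntax; ∃-syntax; _×_; _,_)
open import Data.Product.Properties using (≡-dec)
open import Data.Rational.Base as ℚ using (ℚ; 0ℚ; 1ℚ)
open import Data.Sum.Base using (_⊎_)
open import Data.Unit.Base using (⊤)
open import Function.Bundles using (_↔_; Inverse)
open import Function.Properties.Inverse using (↔-sym)
open import Level using (0ℓ)
open import Relation.Binary.Core using (Rel)
open import Relation.Binary.Definitions
  using (Decidable; DecidableEquality; Irreflexive; Symmetric)
open import Relation.Binary.PropositionalEquality
  using (_≡_; _≢_; refl; cong₂; isEquivalence; ≢-sym)
open import Relation.Nullary.Decidable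
  using (Dec; map′; ¬?; _→-dec_; from-yes)
open import Relation.Nullary.Negation using (¬_)
open import Relation.Unary using (Pred)
import Relation.Unary as Unary

------------------------------------------------------------------------
-- Graphs

-- Finite, as is every graph here. Adjacency is decidable so that the edges
-- form a (classical) set of pairs.
record SimpleGraph : Set₁ where
  field
    Vertex : Set
    order  : ℕ
    finite : Vertex ↔ Fin order
    Adj    : Rel Vertex 0ℓ
    adj?   : Decidable Adj
    irrefl : Irreflexive _≡_ Adj
    symm   : Symmetric Adj

record SignifiedGraph : Set₁ where
  field
    graph : SimpleGraph
  open SimpleGraph graph public
  field
    Negative  : Rel Vertex 0ℓ
    negative? : Decidable Negative
    neg-symm  : Symmetric Negative
    neg⇒adj   : ∀ {u v} → Negative u v → Adj u v

  Positive : Rel Vertex 0ℓ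
  Positive u v = Adj u v × ¬ Negative u v

open SignifiedGraph using (graph; Vertex; order; Negative; Positive)

record IsHom (G H : SignifiedGraph) (f : Vertex G → Vertex H) : Set where
  field
    pres-negative : ∀ {u v} → Negative G u v → Negative H (f u) (f v)
    pres-positive : ∀ {u v} → Positive G u v → Positive H (f u) (f v)

Hom : SignifiedGraph → SignifiedGraph → Set
Hom G H = Σ[ f ∈ (Vertex G → Vertex H) ] IsHom G H f

record Iso (G H : SignifiedGraph) : Set where
  field
    bijection : Vertex G ↔ Vertex H
    to-hom    : IsHom G H (Inverse.to bijection)
    from-hom  : IsHom H G (Inverse.from bijection)

------------------------------------------------------------------------
-- Plane drawings with polygonal arcs
--
-- Vertices and bends have rational coordinates. For finite graphs this loses
-- nothing compared with ℝ²: a drawing may be taken polygonal, and its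
-- vertices and bends may then be moved to nearby rational points. Two
-- segments with rational ends that meet in ℝ² also meet in a rational point,
-- so disjointness may be tested on rational points.

Point : Set
Point = ℚ × ℚ

-- x lies on the closed segment from p to q.
_∈[_,_] : Point → Point → Point → Set
(x₁ , x₂) ∈[ (p₁ , p₂) , (q₁ , q₂) ] =
  ∃[ t ] 0ℚ ℚ.≤ t × t ℚ.≤ 1ℚ
       × x₁ ≡ p₁ ℚ.+ t ℚ.* (q₁ ℚ.- p₁)
       × x₂ ≡ p₂ ℚ.+ t ℚ.* (q₂ ℚ.- p₂)

-- The point set of the polygonal curve that starts at p and then visits the
-- listed points in order.
OnCurve : Point → List Point → Pred Point 0ℓ
OnCurve p []       x = x ≡ p
OnCurve p (q ∷ qs) x = x ∈[ p , q ] ⊎ OnCurve q qs x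

-- The curve does not meet itself.
SimpleCurve : Point → List Point → Set
SimpleCurve p []       = ⊤
SimpleCurve p (q ∷ qs) =
  (∀ x → x ∈[ p , q ] → OnCurve q qs x → x ≡ q) × SimpleCurve q qs

Outside : ℚ → Pred Point 0ℓ
Outside B (x₁ , x₂) = B ℚ.< ℚ.∣ x₁ ∣ ⊎ B ℚ.< ℚ.∣ x₂ ∣

module _ (G : SimpleGraph) where
  open SimpleGraph G using (Adj) renaming (Vertex to V)

  record PlaneDrawing : Set where
    field
      pos   : V → Point
      bends : V → V → List Point

    -- Only used for adjacent u and v.
    Arc : V → V → Pred Point 0ℓ
    Arc u v = OnCurve (pos u) (bends u v ∷ʳ pos v)

    field
      pos-injective : ∀ {u v} → pos u ≡ pos v → u ≡ v
      bends-reverse : ∀ {u v} → Adj u v → bends v u ≡ reverse (bends u v)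
      arc-simple    : ∀ {u v} → Adj u v →
                      SimpleCurve (pos u) (bends u v ∷ʳ pos v)
      arc-vertex    : ∀ {u v w} → Adj u v → Arc u v (pos w) → w ≡ u ⊎ w ≡ v
      -- Arcs of two different edges meet only in common ends.
      arc-arc       : ∀ {u v w z x} → Adj u v → Adj w z →
                      Arc u v x → Arc w z x →
                      ((u ≡ w × v ≡ z) ⊎ (u ≡ z × v ≡ w))
                      ⊎ (∃[ y ] x ≡ pos y × (y ≡ u ⊎ y ≡ v) × (y ≡ w ⊎ y ≡ z))

    Drawn : Pred Point 0ℓ
    Drawn x = (∃[ v ] x ≡ pos v) ⊎ (∃[ u ] ∃[ v ] Adj u v × Arc u v x)

    -- v is on the boundary of the unbounded face: polygonal curves that meet
    -- the drawing only in v lead from v to points arbitrarily far away.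
    OnOuterFace : Pred V 0ℓ
    OnOuterFace v =
      ∀ B → ∃[ ps ] ∃[ q ] Outside B q ×
        (∀ x → OnCurve (pos v) (ps ∷ʳ q) x → Drawn x → x ≡ pos v)

  Outerplanar : Set
  Outerplanar =
    Σ[ D ∈ PlaneDrawing ] (∀ v → PlaneDrawing.OnOuterFace D v)

------------------------------------------------------------------------
-- The field with nine elements, as 𝔽₃[i] with i² = -1

𝔽₉ : Set
𝔽₉ = Fin 3 × Fin 3

infixl 6 _+₃_
infixl 7 _*₃_

_+₃_ _*₃_ : Fin 3 → Fin 3 → Fin 3
a +₃ b = (toℕ a ℕ.+ toℕ b) mod 3
a *₃ b = (toℕ a ℕ.* toℕ b) mod 3

neg₃ : Fin 3 → Fin 3
neg₃ a = (3 ℕ.∸ toℕ a) mod 3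

infixl 6 _+₉_ _-₉_
infixl 7 _*₉_

_+₉_ _*₉_ _-₉_ : 𝔽₉ → 𝔽₉ → 𝔽₉
(a , b) +₉ (c , d) = (a +₃ c) , (b +₃ d)
(a , b) *₉ (c , d) = (a *₃ c +₃ neg₃ (b *₃ d)) , (a *₃ d +₃ b *₃ c)

neg₉ : 𝔽₉ → 𝔽₉
neg₉ (a , b) = neg₃ a , neg₃ b

x -₉ y = x +₉ neg₉ y

0₉ 1₉ : 𝔽₉
0₉ = zero , zero
1₉ = suc zero , zero

_≟₉_ : DecidableEquality 𝔽₉
_≟₉_ = ≡-dec Fin._≟_ Fin._≟_

all₉? : ∀ {P : Pred 𝔽₉ 0ℓ} → Unary.Decidable P → Dec (∀ x → P x)
all₉? P? = map′ (λ h (a , b) → h a b) (λ h a b → h (a , b))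
  (Fin.all? λ a → Fin.all? λ b → P? (a , b))

any₉? : ∀ {P : Pred 𝔽₉ 0ℓ} → Unary.Decidable P → Dec (∃[ x ] P x)
any₉? P? = map′ (λ (a , b , p) → (a , b) , p) (λ ((a , b) , p) → a , b , p)
  (Fin.any? λ a → Fin.any? λ b → P? (a , b))

𝔽₉-isCommutativeRing : IsCommutativeRing _≡_ _+₉_ _*₉_ neg₉ 0₉ 1₉
𝔽₉-isCommutativeRing = record
  { isRing = record
    { +-isAbelianGroup = record
      { isGroup = record
        { isMonoid = record
          { isSemigroup = record
            { isMagma = record
              { isEquivalence = isEquivalence ; ∙-cong = cong₂ _+₉_ }
            ; assoc = from-yes (all₉? λ x → all₉? λ y → all₉? λ z →
                ((x +₉ y) +₉ z) ≟₉ (x +₉ (y +₉ z)))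
            }
          ; identity = from-yes (all₉? λ x → (0₉ +₉ x) ≟₉ x)
                     , from-yes (all₉? λ x → (x +₉ 0₉) ≟₉ x)
          }
        ; inverse = from-yes (all₉? λ x → (neg₉ x +₉ x) ≟₉ 0₉)
                  , from-yes (all₉? λ x → (x +₉ neg₉ x) ≟₉ 0₉)
        ; ⁻¹-cong = λ { refl → refl }
        }
      ; comm = from-yes (all₉? λ x → all₉? λ y → (x +₉ y) ≟₉ (y +₉ x))
      }
    ; *-cong = cong₂ _*₉_
    ; *-assoc = from-yes (all₉? λ x → all₉? λ y → all₉? λ z →
        ((x *₉ y) *₉ z) ≟₉ (x *₉ (y *₉ z)))
    ; *-identity = from-yes (all₉? λ x → (1₉ *₉ x) ≟₉ x)
                 , from-yes (all₉? λ x → (x *₉ 1₉) ≟₉ x)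
    ; distrib = from-yes (all₉? λ x → all₉? λ y → all₉? λ z →
                  (x *₉ (y +₉ z)) ≟₉ ((x *₉ y) +₉ (x *₉ z)))
              , from-yes (all₉? λ x → all₉? λ y → all₉? λ z →
                  ((y +₉ z) *₉ x) ≟₉ ((y *₉ x) +₉ (z *₉ x)))
    }
  ; *-comm = from-yes (all₉? λ x → all₉? λ y → (x *₉ y) ≟₉ (y *₉ x))
  }

𝔽₉-invertible : ∀ x → x ≢ 0₉ → ∃[ y ] x *₉ y ≡ 1₉
𝔽₉-invertible = from-yes (all₉? λ x →
  ¬? (x ≟₉ 0₉) →-dec any₉? λ y → (x *₉ y) ≟₉ 1₉)

Square : Pred 𝔽₉ 0ℓ
Square x = ∃[ y ] y *₉ y ≡ x

square? : Unary.Decidable Square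
square? x = any₉? λ y → (y *₉ y) ≟₉ x

------------------------------------------------------------------------
-- SP₉

K₉ : SimpleGraph
K₉ = record
  { Vertex = 𝔽₉
  ; order  = 9
  ; finite = ↔-sym *↔×
  ; Adj    = _≢_
  ; adj?   = λ x y → ¬? (x ≟₉ y)
  ; irrefl = λ x≡y x≢y → x≢y x≡y
  ; symm   = ≢-sym
  }

-- Distinctness of the ends need not be required: 0 is a square.
NonSquareDifference : Rel 𝔽₉ 0ℓ
NonSquareDifference x y = ¬ Square (y -₉ x)

SP₉ : SignifiedGraph
SP₉ = record
  { graph     = K₉
  ; Negative  = NonSquareDifference
  ; negative? = λ x y → ¬? (square? (y -₉ x))
  ; neg-symm  = λ {x} {y} → from-yes (all₉? λ x → all₉? λ y →
      ¬? (square? (y -₉ x)) →-dec ¬? (square? (x -₉ y))) x y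
  ; neg⇒adj   = λ {x} {y} → from-yes (all₉? λ x → all₉? λ y →
      ¬? (square? (y -₉ x)) →-dec ¬? (x ≟₉ y)) x y
  }

{-# OPTIONS --safe #-}
-- Points on the parabola y = x² are in convex position, and every vertex sees
-- infinity straight below it, so a graph drawn with non-crossing chords of the
-- parabola is outerplanar. Such a graph stays one when to each vertex v a fan
-- is attached: a path with alternating signs, all of it joined to v by edges
-- of one sign. If x has no long alternating walk among its s-neighbours, then
-- fans of sign s keep x out of the image. Discarding such vertices leaves a
-- nonempty set S in which, for every x and s, the s-neighbours of x contain
-- long alternating walks. Discarding ends of walks in the same way leaves a
-- nonempty set of s-neighbours of x, each having both a + and a - neighbour in
-- it; such a set has at least 4 elements. As 1 + 4 + 4 = 9, H is complete, has
-- degree 4 in each sign, and the ends of an s-edge have a common s-neighbour.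
-- Counting w with sign(uw) = sign(vw) over all u shows that this common
-- s-neighbour is unique. Hence the positive edges form the 3 × 3 rook's graph,
-- which is the graph of square differences in 𝔽₉.
module Submission where

open import Defs
open import Data.Bool.Base using (if_then_else_)
open import Data.Empty using (⊥; ⊥-elim)
open import Data.Fin.Base using (Fin; zero; suc; toℕ; punchOut)
open import Data.Fin.Patterns using (0F; 1F; 2F)
import Data.Fin.Properties as Fin
import Data.Integer.Base as ℤ
import Data.Integer.Properties as ℤ
open import Data.List.Base using (List; []; _∷_; _++_; allFin; filter; length)
open import Data.List.Membership.Propositional using (_∈_; find; lose)
open import Data.List.Membership.Propositional.Properties
  using (∈-++⁻; ∈-allFin; ∈-filter⁺; ∈-filter⁻)
open import Data.List.Properties using (filter-notAll; length-++)
open import Data.List.Relation.Unary.All as All using (All; []; _∷_)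
import Data.List.Relation.Unary.All.Properties as All
open import Data.List.Relation.Unary.Any as Any using (Any; here)
open import Data.List.Relation.Unary.Unique.Propositional using (Unique; []; _∷_)
open import Data.List.Relation.Unary.Unique.Propositional.Properties using (++⁺)
open import Data.Maybe.Base using (Maybe; just; nothing)
open import Data.Nat.Base as ℕ using (ℕ; zero; suc; z≤n; s≤s; _+_; _*_; _≤_)
import Data.Nat.Properties as ℕ
open import Algebra.Properties.Semiring.Sum ℕ.+-*-semiring
  using (sum; sum-cong-≗; ∑-comm; ∑-distrib-+; *-distribˡ-sum; *-distribʳ-sum)
open import Data.Nat.Solver using () renaming (module +-*-Solver to ℕ-Solver)
open import Data.Product.Base using (∃-syntax; _×_; _,_; proj₁; proj₂)
open import Data.Product.Function.NonDependent.Propositional using (_×-↔_)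
open import Data.Rational.Base as ℚ using (ℚ; 0ℚ; 1ℚ; *≤*)
open import Data.Rational.Literals using (fromℤ)
import Data.Rational.Properties as ℚ
open import Data.Rational.Solver using () renaming (module +-*-Solver to ℚ-Solver)
open import Data.Sign.Base as Sign using (Sign; opposite)
open import Data.Sum.Base using (_⊎_; inj₁; inj₂)
open import Data.Unit.Base using (tt)
open import Function.Base using (case_of_)
open import Function.Bundles using (Injection; Inverse; _↔_; mk↔ₛ′)
open import Function.Definitions using (Injective)
open import Function.Properties.Inverse using (↔-refl; ↔-sym; ↔-trans; ↔⇒↣)
open import Relation.Binary.Definitions
  using (Decidable; DecidableEquality; tri<; tri≈; tri>)
open import Relation.Binary.PropositionalEquality
open import Relation.Nullary using (¬_; ¬?; Dec; yes; no; does; contradiction)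
open import Relation.Nullary.Decidable
  using (decidable-stable; from-yes; map′; _×-dec_; _→-dec_; _⊎-dec_)

-- Chord diagrams are outerplanar

0≤* : ∀ {p q} → 0ℚ ℚ.≤ p → 0ℚ ℚ.≤ q → 0ℚ ℚ.≤ p ℚ.* q
0≤* {p} {q} 0≤p 0≤q =
  ℚ.nonNegative⁻¹ (p ℚ.* q) {{ℚ.nonNeg*nonNeg⇒nonNeg p {{ℚ.nonNegative 0≤p}} q {{ℚ.nonNegative 0≤q}}}}

0≤- : ∀ {p q} → p ℚ.≤ q → 0ℚ ℚ.≤ q ℚ.- p
0≤- {p} {q} p≤q = subst (λ r → r ℚ.≤ q ℚ.- p) (ℚ.+-inverseʳ p) (ℚ.+-monoˡ-≤ (ℚ.- p) p≤q)

difference+ : ∀ p q → (q ℚ.- p) ℚ.+ p ≡ q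
difference+ = solve 2 (λ p q → (q :- p) :+ p := q) refl
  where open ℚ-Solver

0≤-⇒≤ : ∀ {p q} → 0ℚ ℚ.≤ q ℚ.- p → p ℚ.≤ q
0≤-⇒≤ {p} {q} 0≤q-p =
  subst₂ ℚ._≤_ (ℚ.+-identityˡ p) (difference+ p q) (ℚ.+-monoˡ-≤ p 0≤q-p)

-≡0⇒≡ : ∀ {p q} → q ℚ.- p ≡ 0ℚ → p ≡ q
-≡0⇒≡ {p} {q} eq =
  trans (sym (ℚ.+-identityˡ p)) (trans (cong (ℚ._+ p) (sym eq)) (difference+ p q))

*≡0⇒≡0 : ∀ p q → p ℚ.* q ≡ 0ℚ → p ≡ 0ℚ ⊎ q ≡ 0ℚ
*≡0⇒≡0 p q pq≡0 with p ℚ.≟ 0ℚ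
... | yes p≡0 = inj₁ p≡0
... | no  p≢0 = inj₂ (begin
    q                        ≡⟨ ℚ.*-identityˡ q ⟨
    1ℚ ℚ.* q                 ≡⟨ cong (ℚ._* q) (ℚ.*-inverseˡ p) ⟨
    ((ℚ.1/ p) ℚ.* p) ℚ.* q   ≡⟨ ℚ.*-assoc (ℚ.1/ p) p q ⟩
    (ℚ.1/ p) ℚ.* (p ℚ.* q)   ≡⟨ cong ((ℚ.1/ p) ℚ.*_) pq≡0 ⟩
    (ℚ.1/ p) ℚ.* 0ℚ          ≡⟨ ℚ.*-zeroʳ (ℚ.1/ p) ⟩
    0ℚ                       ∎)
  where
  open ≡-Reasoning
  instance
    p≠0 : ℚ.NonZero p
    p≠0 = ℚ.≢-nonZero p≢0

nonneg-sum≡0 : ∀ {p q} → 0ℚ ℚ.≤ p → 0ℚ ℚ.≤ q → p ℚ.+ q ≡ 0ℚ → p ≡ 0ℚ × q ≡ 0ℚ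
nonneg-sum≡0 {p} {q} 0≤p 0≤q p+q≡0 =
    ℚ.≤-antisym (subst₂ ℚ._≤_ (ℚ.+-identityʳ p) p+q≡0 (ℚ.+-monoʳ-≤ p 0≤q)) 0≤p
  , ℚ.≤-antisym (subst₂ ℚ._≤_ (ℚ.+-identityˡ q) p+q≡0 (ℚ.+-monoˡ-≤ q 0≤p)) 0≤q

abstract
  -- Abstract, so that coordinates stay atoms for the type checker: later arguments use only
  -- monotonicity, nonnegativity and injectivity.
  ι : ℕ → ℚ
  ι n = fromℤ (ℤ.+ n)

  ι-mono-≤ : ∀ {m n} → m ℕ.≤ n → ι m ℚ.≤ ι n
  ι-mono-≤ m≤n = *≤* (ℤ.*-monoʳ-≤-nonNeg ℤ.1ℤ (ℤ.+≤+ m≤n))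

  0≤ι : ∀ n → 0ℚ ℚ.≤ ι n
  0≤ι n = ι-mono-≤ {0} {n} ℕ.z≤n

  ι-injective : ∀ {m n} → ι m ≡ ι n → m ≡ n
  ι-injective eq = ℤ.+-injective (cong ℚ.numerator eq)

-- Chords of the parabola

onParabola : ℚ → Point
onParabola a = a , a ℚ.* a

-- Membership in the segment between the parabola points at a and b, without its parameter: `height`
-- factors the vertical distance over the parabola, and `left` and `right` make both factors
-- nonnegative.
record Chord (a b : ℚ) (x : Point) : Set where
  constructor chord
  field
    left   : 0ℚ ℚ.≤ proj₁ x ℚ.- a
    right  : 0ℚ ℚ.≤ b ℚ.- proj₁ x
    height : proj₂ x ℚ.- proj₁ x ℚ.* proj₁ x ≡ (proj₁ x ℚ.- a) ℚ.* (b ℚ.- proj₁ x)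

open Chord

segment-height : ∀ a b t → let x = a ℚ.+ t ℚ.* (b ℚ.- a) in
  (a ℚ.* a ℚ.+ t ℚ.* (b ℚ.* b ℚ.- a ℚ.* a)) ℚ.- x ℚ.* x ≡ (x ℚ.- a) ℚ.* (b ℚ.- x)
segment-height = solve 3 (λ a b t → let x = a :+ t :* (b :- a) in
  (a :* a :+ t :* (b :* b :- a :* a)) :- x :* x := (x :- a) :* (b :- x)) refl
  where open ℚ-Solver

segment⇒chord : ∀ {a b x} → a ℚ.≤ b → x ∈[ onParabola a , onParabola b ] → Chord a b x
segment⇒chord {a} {b} a≤b (t , 0≤t , t≤1 , refl , refl) = chord
  (subst (0ℚ ℚ.≤_) (eqˡ a b t) (0≤* 0≤t (0≤- a≤b)))
  (subst (0ℚ ℚ.≤_) (eqʳ a b t) (0≤* (0≤- t≤1) (0≤- a≤b)))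
  (segment-height a b t)
  where
  open ℚ-Solver
  eqˡ : ∀ a b t → t ℚ.* (b ℚ.- a) ≡ (a ℚ.+ t ℚ.* (b ℚ.- a)) ℚ.- a
  eqˡ = solve 3 (λ a b t → t :* (b :- a) := (a :+ t :* (b :- a)) :- a) refl
  eqʳ : ∀ a b t → (1ℚ ℚ.- t) ℚ.* (b ℚ.- a) ≡ b ℚ.- (a ℚ.+ t ℚ.* (b ℚ.- a))
  eqʳ = solve 3 (λ a b t → (con 1ℚ :- t) :* (b :- a) := b :- (a :+ t :* (b :- a))) refl

segment-sym : ∀ p q {x} → x ∈[ p , q ] → x ∈[ q , p ]
segment-sym (p₁ , p₂) (q₁ , q₂) (t , 0≤t , t≤1 , refl , refl) =
  (1ℚ ℚ.- t) , 0≤- t≤1 , 0≤-⇒≤ (subst (0ℚ ℚ.≤_) (eq t) 0≤t) , swap p₁ q₁ t , swap p₂ q₂ t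
  where
  open ℚ-Solver
  eq : ∀ t → t ≡ 1ℚ ℚ.- (1ℚ ℚ.- t)
  eq = solve 1 (λ t → t := con 1ℚ :- (con 1ℚ :- t)) refl
  swap : ∀ p q t → p ℚ.+ t ℚ.* (q ℚ.- p) ≡ q ℚ.+ (1ℚ ℚ.- t) ℚ.* (p ℚ.- q)
  swap = solve 3 (λ p q t → p :+ t :* (q :- p) := q :+ (con 1ℚ :- t) :* (p :- q)) refl

end∈segment : ∀ p q → q ∈[ p , q ]
end∈segment (p₁ , p₂) (q₁ , q₂) = 1ℚ , ℚ.nonNegative⁻¹ 1ℚ , ℚ.≤-refl , eq p₁ q₁ , eq p₂ q₂
  where
  open ℚ-Solver
  eq : ∀ p q → q ≡ p ℚ.+ 1ℚ ℚ.* (q ℚ.- p)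
  eq = solve 2 (λ p q → q := p :+ con 1ℚ :* (q :- p)) refl

straight⇒segment : ∀ p q {x} → OnCurve p (q ∷ []) x → x ∈[ p , q ]
straight⇒segment p q (inj₁ x∈)   = x∈
straight⇒segment p q (inj₂ refl) = end∈segment p q

height≡0 : ∀ {a b x} → Chord a b x → (proj₁ x ℚ.- a) ℚ.* (b ℚ.- proj₁ x) ≡ 0ℚ →
           x ≡ onParabola (proj₁ x)
height≡0 c eq = cong (_ ,_) (sym (-≡0⇒≡ (trans (height c) eq)))

chord-at-left : ∀ {a b x} → Chord a b x → proj₁ x ≡ a → x ≡ onParabola a
chord-at-left {a} {b} c refl = height≡0 c
  (trans (cong (ℚ._* (b ℚ.- a)) (ℚ.+-inverseʳ a)) (ℚ.*-zeroˡ (b ℚ.- a)))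

chord-at-right : ∀ {a b x} → Chord a b x → proj₁ x ≡ b → x ≡ onParabola b
chord-at-right {a} {b} c refl = height≡0 c
  (trans (cong ((b ℚ.- a) ℚ.*_) (ℚ.+-inverseʳ b)) (ℚ.*-zeroʳ (b ℚ.- a)))

-- The height over the parabola is zero there, so one of its two factors vanishes.
chord-on-parabola : ∀ {a b c} → Chord a b (onParabola c) → c ≡ a ⊎ c ≡ b
chord-on-parabola {a} {b} {c} ch
  with *≡0⇒≡0 (c ℚ.- a) (b ℚ.- c) (trans (sym (height ch)) (ℚ.+-inverseʳ (c ℚ.* c)))
... | inj₁ c-a≡0 = inj₁ (sym (-≡0⇒≡ c-a≡0))
... | inj₂ b-c≡0 = inj₂ (-≡0⇒≡ b-c≡0)

chord-above : ∀ {a b x} → Chord a b x → proj₁ x ℚ.* proj₁ x ℚ.≤ proj₂ x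
chord-above c = 0≤-⇒≤ (subst (0ℚ ℚ.≤_) (sym (height c)) (0≤* (left c) (right c)))

MeetAtEnd : ℚ → ℚ → ℚ → ℚ → Point → Set
MeetAtEnd a b c d x = ∃[ e ] x ≡ onParabola e × (e ≡ a ⊎ e ≡ b) × (e ≡ c ⊎ e ≡ d)

meet-disjoint : ∀ {a b c d x} → b ℚ.≤ c → Chord a b x → Chord c d x → MeetAtEnd a b c d x
meet-disjoint {b = b} {c} {x = x₁ , _} b≤c k l =
  b , chord-at-right k x₁≡b , inj₂ refl , inj₁ (ℚ.≤-antisym b≤c (subst (c ℚ.≤_) x₁≡b c≤x₁))
  where
  c≤x₁ : c ℚ.≤ x₁
  c≤x₁ = 0≤-⇒≤ (left l)
  x₁≡b : x₁ ≡ b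
  x₁≡b = ℚ.≤-antisym (0≤-⇒≤ (right k)) (ℚ.≤-trans b≤c c≤x₁)

height-difference : ∀ a b c d x →
  (c ℚ.- a) ℚ.* (b ℚ.- x) ℚ.+ (x ℚ.- c) ℚ.* (b ℚ.- d) ≡
  (x ℚ.- a) ℚ.* (b ℚ.- x) ℚ.- (x ℚ.- c) ℚ.* (d ℚ.- x)
height-difference = solve 5 (λ a b c d x →
  (c :- a) :* (b :- x) :+ (x :- c) :* (b :- d) :=
  (x :- a) :* (b :- x) :- (x :- c) :* (d :- x)) refl
  where open ℚ-Solver

-- The chords have the same height over the parabola at x, and the height
-- difference is a sum of two nonnegative terms.
meet-nested : ∀ {a b c d x} → a ℚ.≤ c → d ℚ.≤ b → Chord a b x → Chord c d x →
              (a ≡ c × b ≡ d) ⊎ MeetAtEnd a b c d x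
meet-nested {a} {b} {c} {d} {x₁ , x₂} a≤c d≤b k l =
  cases (*≡0⇒≡0 (c ℚ.- a) (b ℚ.- x₁) (proj₁ summands≡0))
        (*≡0⇒≡0 (x₁ ℚ.- c) (b ℚ.- d) (proj₂ summands≡0))
  where
  sum≡0 : (c ℚ.- a) ℚ.* (b ℚ.- x₁) ℚ.+ (x₁ ℚ.- c) ℚ.* (b ℚ.- d) ≡ 0ℚ
  sum≡0 = trans (height-difference a b c d x₁)
         (trans (cong₂ ℚ._-_ (sym (height k)) (sym (height l)))
                (ℚ.+-inverseʳ (x₂ ℚ.- x₁ ℚ.* x₁)))

  summands≡0 : (c ℚ.- a) ℚ.* (b ℚ.- x₁) ≡ 0ℚ × (x₁ ℚ.- c) ℚ.* (b ℚ.- d) ≡ 0ℚ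
  summands≡0 = nonneg-sum≡0 (0≤* (0≤- a≤c) (right k)) (0≤* (left l) (0≤- d≤b)) sum≡0

  cases : c ℚ.- a ≡ 0ℚ ⊎ b ℚ.- x₁ ≡ 0ℚ → x₁ ℚ.- c ≡ 0ℚ ⊎ b ℚ.- d ≡ 0ℚ →
          (a ≡ c × b ≡ d) ⊎ MeetAtEnd a b c d (x₁ , x₂)
  cases (inj₁ ca) (inj₂ bd) = inj₁ (-≡0⇒≡ ca , sym (-≡0⇒≡ bd))
  cases (inj₁ ca) (inj₁ xc) =
    inj₂ (c , chord-at-left l (sym (-≡0⇒≡ xc)) , inj₁ (sym (-≡0⇒≡ ca)) , inj₁ refl)
  cases (inj₂ bx) _         =
    inj₂ (b , chord-at-right k (-≡0⇒≡ bx) , inj₂ refl , inj₂ (ℚ.≤-antisym b≤d d≤b))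
    where
    b≤d : b ℚ.≤ d
    b≤d = subst (λ e → e ℚ.≤ d) (-≡0⇒≡ bx) (0≤-⇒≤ (right l))

-- `sign` encodes adjacency and sign at once, with `nothing` for non-edges. In `non-crossing` each
-- chord is read from its left end; as `sign` is symmetric, this covers all orientations.
record ChordDiagram : Set₁ where
  field
    Vertex          : Set
    order           : ℕ
    finite          : Vertex ↔ Fin order
    label           : Vertex → ℕ
    label-injective : ∀ {u v} → label u ≡ label v → u ≡ v
    sign            : Vertex → Vertex → Maybe Sign
    sign-sym        : ∀ u v → sign u v ≡ sign v u
    sign-irrefl     : ∀ u → sign u u ≡ nothing
    non-crossing    : ∀ {u v w z s t} → sign u v ≡ just s → sign w z ≡ just t →
                      label u ℕ.< label w → label w ℕ.< label v → label v ℕ.< label z → ⊥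

module _ (D : ChordDiagram) where
  open ChordDiagram D

  joined? : ∀ (m : Maybe Sign) → Dec (∃[ s ] m ≡ just s)
  joined? (just s) = yes (s , refl)
  joined? nothing  = no λ ()

  negative-edge? : ∀ (m : Maybe Sign) → Dec (m ≡ just Sign.-)
  negative-edge? (just Sign.-) = yes refl
  negative-edge? (just Sign.+) = no λ ()
  negative-edge? nothing       = no λ ()

  simpleGraph : SimpleGraph
  simpleGraph = record
    { Vertex = Vertex
    ; order  = order
    ; finite = finite
    ; Adj    = λ u v → ∃[ s ] sign u v ≡ just s
    ; adj?   = λ u v → joined? (sign u v)
    ; irrefl = λ { {u} refl (s , e) → case trans (sym (sign-irrefl u)) e of λ () }
    ; symm   = λ { {u} {v} (s , e) → s , trans (sign-sym v u) e }
    }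

  signifiedGraph : SignifiedGraph
  signifiedGraph = record
    { graph     = simpleGraph
    ; Negative  = λ u v → sign u v ≡ just Sign.-
    ; negative? = λ u v → negative-edge? (sign u v)
    ; neg-symm  = λ {u} {v} e → trans (sign-sym v u) e
    ; neg⇒adj   = λ e → Sign.- , e
    }

  open SimpleGraph simpleGraph using (Adj; symm)

  private
    at : Vertex → ℚ
    at v = ι (label v)

    pos : Vertex → Point
    pos v = onParabola (at v)

    at-injective : ∀ {u v} → at u ≡ at v → u ≡ v
    at-injective e = label-injective (ι-injective e)

    data Oriented (u v : Vertex) (x : Point) : Set where
      forward  : label u ℕ.< label v → Chord (at u) (at v) x → Oriented u v x
      backward : label v ℕ.< label u → Chord (at v) (at u) x → Oriented u v x

    orient : ∀ {u v x} → Adj u v → OnCurve (pos u) (pos v ∷ []) x → Oriented u v x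
    orient {u} {v} (s , e) x∈ with ℕ.<-cmp (label u) (label v)
    ... | tri< u<v _ _ =
      forward u<v (segment⇒chord (ι-mono-≤ (ℕ.<⇒≤ u<v)) (straight⇒segment (pos u) (pos v) x∈))
    ... | tri> _ _ v<u =
      backward v<u (segment⇒chord (ι-mono-≤ (ℕ.<⇒≤ v<u))
        (segment-sym (pos u) (pos v) (straight⇒segment (pos u) (pos v) x∈)))
    ... | tri≈ _ u≡v _ = ⊥-elim (SimpleGraph.irrefl simpleGraph (label-injective u≡v) (s , e))

    Meet : (u v w z : Vertex) → Point → Set
    Meet u v w z x = ((u ≡ w × v ≡ z) ⊎ (u ≡ z × v ≡ w))
                   ⊎ (∃[ y ] x ≡ pos y × (y ≡ u ⊎ y ≡ v) × (y ≡ w ⊎ y ≡ z))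

    fromEnds : ∀ {u v w z x} → MeetAtEnd (at u) (at v) (at w) (at z) x → Meet u v w z x
    fromEnds {u} {v} {w} {z} (e , refl , inj₁ e≡u , e∈) =
      inj₂ (u , cong onParabola e≡u , inj₁ refl , which e∈)
      where
      which : e ≡ at w ⊎ e ≡ at z → u ≡ w ⊎ u ≡ z
      which (inj₁ e≡w) = inj₁ (at-injective (trans (sym e≡u) e≡w))
      which (inj₂ e≡z) = inj₂ (at-injective (trans (sym e≡u) e≡z))
    fromEnds {u} {v} {w} {z} (e , refl , inj₂ e≡v , e∈) =
      inj₂ (v , cong onParabola e≡v , inj₂ refl , which e∈)
      where
      which : e ≡ at w ⊎ e ≡ at z → v ≡ w ⊎ v ≡ z
      which (inj₁ e≡w) = inj₁ (at-injective (trans (sym e≡v) e≡w))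
      which (inj₂ e≡z) = inj₂ (at-injective (trans (sym e≡v) e≡z))

    fromNested : ∀ {u v w z x} →
      (at u ≡ at w × at v ≡ at z) ⊎ MeetAtEnd (at u) (at v) (at w) (at z) x → Meet u v w z x
    fromNested (inj₁ (e , f)) = inj₁ (inj₁ (at-injective e , at-injective f))
    fromNested (inj₂ m)       = fromEnds m

    meet-swap : ∀ {u v w z x} → Meet u v w z x → Meet w z u v x
    meet-swap (inj₁ (inj₁ (e , f)))    = inj₁ (inj₁ (sym e , sym f))
    meet-swap (inj₁ (inj₂ (e , f)))    = inj₁ (inj₂ (sym f , sym e))
    meet-swap (inj₂ (y , e , y∈ , y∈′)) = inj₂ (y , e , y∈′ , y∈)

    meet-revˡ : ∀ {u v w z x} → Meet u v w z x → Meet v u w z x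
    meet-revˡ (inj₁ (inj₁ (e , f)))             = inj₁ (inj₂ (f , e))
    meet-revˡ (inj₁ (inj₂ (e , f)))             = inj₁ (inj₁ (f , e))
    meet-revˡ (inj₂ (y , e , inj₁ y≡u , y∈)) = inj₂ (y , e , inj₂ y≡u , y∈)
    meet-revˡ (inj₂ (y , e , inj₂ y≡v , y∈)) = inj₂ (y , e , inj₁ y≡v , y∈)

    meet-revʳ : ∀ {u v w z x} → Meet u v w z x → Meet u v z w x
    meet-revʳ m = meet-swap (meet-revˡ (meet-swap m))

    -- Comparing the four labels leaves three situations: the label intervals overlap in at most an
    -- end, or one contains the other, or they interleave, which `non-crossing` excludes.
    meet-chords : ∀ {u v w z x} → Adj u v → Adj w z →
      label u ℕ.< label v → label w ℕ.< label z →
      Chord (at u) (at v) x → Chord (at w) (at z) x → Meet u v w z x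
    meet-chords {u} {v} {w} {z} (_ , uv) (_ , wz) u<v w<z k l
      with ℕ.<-≤-connex (label w) (label v) | ℕ.<-≤-connex (label u) (label z)
    ... | inj₂ v≤w | _        = fromEnds (meet-disjoint (ι-mono-≤ v≤w) k l)
    ... | inj₁ _   | inj₂ z≤u = meet-swap (fromEnds (meet-disjoint (ι-mono-≤ z≤u) l k))
    ... | inj₁ w<v | inj₁ u<z
      with ℕ.<-cmp (label u) (label w) | ℕ.<-≤-connex (label v) (label z)
    ...   | tri< u<w _ _ | inj₁ v<z = ⊥-elim (non-crossing uv wz u<w w<v v<z)
    ...   | tri< u<w _ _ | inj₂ z≤v =
      fromNested (meet-nested (ι-mono-≤ (ℕ.<⇒≤ u<w)) (ι-mono-≤ z≤v) k l)
    ...   | tri≈ _ u≡w _ | inj₂ z≤v =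
      fromNested (meet-nested (ι-mono-≤ (ℕ.≤-reflexive u≡w)) (ι-mono-≤ z≤v) k l)
    ...   | tri≈ _ u≡w _ | inj₁ v<z = meet-swap (fromNested
      (meet-nested (ι-mono-≤ (ℕ.≤-reflexive (sym u≡w))) (ι-mono-≤ (ℕ.<⇒≤ v<z)) l k))
    ...   | tri> _ _ w<u | inj₁ v<z = meet-swap (fromNested
      (meet-nested (ι-mono-≤ (ℕ.<⇒≤ w<u)) (ι-mono-≤ (ℕ.<⇒≤ v<z)) l k))
    ...   | tri> _ _ w<u | inj₂ z≤v with ℕ.m≤n⇒m<n∨m≡n z≤v
    ...     | inj₁ z<v = ⊥-elim (non-crossing wz uv w<u u<z z<v)
    ...     | inj₂ z≡v = meet-swap (fromNested
      (meet-nested (ι-mono-≤ (ℕ.<⇒≤ w<u)) (ι-mono-≤ (ℕ.≤-reflexive (sym z≡v))) l k))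

    drawing : PlaneDrawing simpleGraph
    drawing = record
      { pos           = pos
      ; bends         = λ _ _ → []
      ; pos-injective = λ e → at-injective (cong proj₁ e)
      ; bends-reverse = λ _ → refl
      ; arc-simple    = λ _ → (λ _ _ x≡q → x≡q) , tt
      ; arc-vertex    = λ uv x∈ → ends (orient uv x∈)
      ; arc-arc       = λ uv wz x∈ x∈′ → meets uv wz (orient uv x∈) (orient wz x∈′)
      }
      where
      ends : ∀ {u v w} → Oriented u v (pos w) → w ≡ u ⊎ w ≡ v
      ends (forward _ k) with chord-on-parabola k
      ... | inj₁ e = inj₁ (at-injective e)
      ... | inj₂ e = inj₂ (at-injective e)
      ends (backward _ k) with chord-on-parabola k
      ... | inj₁ e = inj₂ (at-injective e)
      ... | inj₂ e = inj₁ (at-injective e)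

      meets : ∀ {u v w z x} → Adj u v → Adj w z → Oriented u v x → Oriented w z x → Meet u v w z x
      meets uv wz (forward  p k) (forward  q l) = meet-chords uv wz p q k l
      meets uv wz (forward  p k) (backward q l) =
        meet-revʳ (meet-chords uv (symm wz) p q k l)
      meets uv wz (backward p k) (forward  q l) =
        meet-revˡ (meet-chords (symm uv) wz p q k l)
      meets uv wz (backward p k) (backward q l) =
        meet-revˡ (meet-revʳ (meet-chords (symm uv) (symm wz) p q k l))

    onOuterFace : ∀ v → PlaneDrawing.OnOuterFace drawing v
    onOuterFace v B = [] , (at v , depth) , inj₂ B<∣depth∣ , only-v
      where
      depth : ℚ
      -- The absolute value makes the depth negative for every B, so the curve from v goes down,
      -- away from the chords; the added 1 makes `Outside` strict.
      depth = ℚ.- (ℚ.∣ B ∣ ℚ.+ 1ℚ)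

      0≤1ℚ : 0ℚ ℚ.≤ 1ℚ
      0≤1ℚ = ℚ.nonNegative⁻¹ 1ℚ

      0≤∣B∣+1 : 0ℚ ℚ.≤ ℚ.∣ B ∣ ℚ.+ 1ℚ
      0≤∣B∣+1 = ℚ.+-mono-≤ (ℚ.0≤∣p∣ B) 0≤1ℚ

      B≤∣B∣ : B ℚ.≤ ℚ.∣ B ∣
      B≤∣B∣ with ℚ.≤-total 0ℚ B
      ... | inj₁ 0≤B = ℚ.≤-reflexive (sym (ℚ.0≤p⇒∣p∣≡p 0≤B))
      ... | inj₂ B≤0 = ℚ.≤-trans B≤0 (ℚ.0≤∣p∣ B)

      B<∣depth∣ : B ℚ.< ℚ.∣ depth ∣
      B<∣depth∣ = subst (B ℚ.<_)
        (sym (trans (ℚ.∣-p∣≡∣p∣ (ℚ.∣ B ∣ ℚ.+ 1ℚ)) (ℚ.0≤p⇒∣p∣≡p 0≤∣B∣+1)))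
        (subst (ℚ._< ℚ.∣ B ∣ ℚ.+ 1ℚ) (ℚ.+-identityʳ B)
          (ℚ.+-mono-≤-< B≤∣B∣ (ℚ.positive⁻¹ 1ℚ)))

      depth≤ : depth ℚ.≤ at v ℚ.* at v
      depth≤ = ℚ.≤-trans (ℚ.neg-antimono-≤ 0≤∣B∣+1)
        (0≤* (0≤ι (label v)) (0≤ι (label v)))

      vertical : ∀ {x : Point} → OnCurve (pos v) ((at v , depth) ∷ []) x →
                 proj₁ x ≡ at v × proj₂ x ℚ.≤ at v ℚ.* at v
      vertical x∈ with straight⇒segment (pos v) (at v , depth) x∈
      ... | t , 0≤t , t≤1 , refl , refl =
          straight (at v) t
        , 0≤-⇒≤ (subst (0ℚ ℚ.≤_) (drop (at v ℚ.* at v) depth t) (0≤* 0≤t (0≤- depth≤)))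
        where
        open ℚ-Solver
        straight : ∀ a t → a ℚ.+ t ℚ.* (a ℚ.- a) ≡ a
        straight = solve 2 (λ a t → a :+ t :* (a :- a) := a) refl
        drop : ∀ a d t → t ℚ.* (a ℚ.- d) ≡ a ℚ.- (a ℚ.+ t ℚ.* (d ℚ.- a))
        drop = solve 3 (λ a d t → t :* (a :- d) := a :- (a :+ t :* (d :- a))) refl

      above : ∀ {u w x} → Oriented u w x → proj₁ x ℚ.* proj₁ x ℚ.≤ proj₂ x
      above (forward  _ k) = chord-above k
      above (backward _ k) = chord-above k

      only-v : ∀ x → OnCurve (pos v) ((at v , depth) ∷ []) x → PlaneDrawing.Drawn drawing x →
               x ≡ pos v
      only-v x x∈ (inj₁ (w , refl)) = cong onParabola (proj₁ (vertical x∈))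
      only-v x x∈ (inj₂ (u , w , uw , x∈′)) with vertical x∈
      ... | refl , below = cong (_ ,_) (ℚ.≤-antisym below (above (orient uw x∈′)))

  outerplanar : Outerplanar simpleGraph
  outerplanar = drawing , onOuterFace

-- Fans over alternating paths

first : ∀ {n} → Sign → Fin n → Maybe Sign
first s zero    = just s
first s (suc _) = nothing

alternating : ∀ {n} → Sign → Fin n → Fin n → Maybe Sign
alternating s zero    zero    = nothing
alternating s zero    (suc j) = first s j
alternating s (suc i) zero    = first s i
alternating s (suc i) (suc j) = alternating (opposite s) i j

alternating-sym : ∀ {n} s (i j : Fin n) → alternating s i j ≡ alternating s j i
alternating-sym s zero    zero    = refl
alternating-sym s zero    (suc _) = refl
alternating-sym s (suc _) zero    = refl
alternating-sym s (suc i) (suc j) = alternating-sym (opposite s) i j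

alternating-irrefl : ∀ {n} s (i : Fin n) → alternating s i i ≡ nothing
alternating-irrefl s zero    = refl
alternating-irrefl s (suc i) = alternating-irrefl (opposite s) i

-- Path edges join consecutive vertices, so no edge from i passes over its successor.
alternating-span : ∀ {n s t} (i j : Fin n) → alternating s i j ≡ just t → toℕ j ℕ.≤ suc (toℕ i)
alternating-span zero       (suc zero) _ = s≤s z≤n
alternating-span (suc _)    zero       _ = z≤n
alternating-span (suc i)    (suc j)    e = s≤s (alternating-span i j e)

fan : ∀ {n} → Sign → Fin (suc n) → Fin (suc n) → Maybe Sign
fan s zero    zero    = nothing
fan s zero    (suc _) = just s
fan s (suc _) zero    = just s
fan s (suc i) (suc j) = alternating Sign.+ i j

fan-sym : ∀ {n} s (i j : Fin (suc n)) → fan s i j ≡ fan s j i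
fan-sym s zero    zero    = refl
fan-sym s zero    (suc _) = refl
fan-sym s (suc _) zero    = refl
fan-sym s (suc i) (suc j) = alternating-sym Sign.+ i j

fan-irrefl : ∀ {n} s (i : Fin (suc n)) → fan s i i ≡ nothing
fan-irrefl s zero    = refl
fan-irrefl s (suc i) = alternating-irrefl Sign.+ i

fan-span : ∀ {n s t} (i j : Fin (suc n)) → fan s i j ≡ just t → 0 ℕ.< toℕ i → toℕ j ℕ.≤ suc (toℕ i)
fan-span (suc i) zero    _ _ = z≤n
fan-span (suc i) (suc j) e _ = s≤s (alternating-span i j e)

-- At most one of i and k is the apex, and only edges at the apex can be long. If i is the apex, the
-- edge from k is too short to have j strictly inside; otherwise the edge from i is too short to
-- have k strictly inside.
fan-non-crossing : ∀ {n s t r} (i j k l : Fin (suc n)) → fan s i j ≡ just t → fan s k l ≡ just r →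
                   toℕ i ℕ.< toℕ k → toℕ k ℕ.< toℕ j → toℕ j ℕ.< toℕ l → ⊥
fan-non-crossing zero    j k l _ e i<k k<j j<l =
  ℕ.<⇒≱ (ℕ.≤-<-trans k<j j<l) (fan-span k l e i<k)
fan-non-crossing (suc i) j k l e _ i<k k<j j<l =
  ℕ.<⇒≱ (ℕ.≤-<-trans i<k k<j) (fan-span (suc i) j e (s≤s z≤n))

-- Mapping this diagram into a set of vertices shows that the set is nonempty.
singleton : ChordDiagram
singleton = record
  { Vertex          = Fin 1
  ; order           = 1
  ; finite          = ↔-refl
  ; label           = toℕ
  ; label-injective = Fin.toℕ-injective
  ; sign            = λ _ _ → nothing
  ; sign-sym        = λ _ _ → refl
  ; sign-irrefl     = λ _ → refl
  ; non-crossing    = λ ()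
  }

-- The vertex (v , 0) replaces v; it is the apex of a fan over the path
-- (v , 1), …, (v , m).
module AttachFans (D : ChordDiagram) (s : Sign) (m : ℕ) where
  open ChordDiagram D

  _≟ᵛ_ : DecidableEquality Vertex
  u ≟ᵛ v = map′ label-injective (cong label) (label u ℕ.≟ label v)

  Vertex⁺ : Set
  Vertex⁺ = Vertex × Fin (suc m)

  old : Vertex → Vertex → (i j : Fin (suc m)) → Maybe Sign
  old u v zero    zero    = sign u v
  old u v zero    (suc _) = nothing
  old u v (suc _) _       = nothing

  sign⁺ : Vertex⁺ → Vertex⁺ → Maybe Sign
  sign⁺ (u , i) (v , j) with u ≟ᵛ v
  ... | yes _ = fan s i j
  ... | no  _ = old u v i j

  data Edge⁺ (t : Sign) : Vertex⁺ → Vertex⁺ → Set where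
    inner : ∀ {u i j} → fan s i j ≡ just t → Edge⁺ t (u , i) (u , j)
    outer : ∀ {u v} → sign u v ≡ just t → Edge⁺ t (u , zero) (v , zero)

  view : ∀ {t} x y → sign⁺ x y ≡ just t → Edge⁺ t x y
  view (u , i) (v , j) e with u ≟ᵛ v
  view (u , i)    (v , j)    e | yes refl = inner e
  view (u , zero) (v , zero) e | no _     = outer e

  sign⁺-inner : ∀ u i j → sign⁺ (u , i) (u , j) ≡ fan s i j
  sign⁺-inner u i j with u ≟ᵛ u
  ... | yes _   = refl
  ... | no  u≢u = contradiction refl u≢u

  sign⁺-outer : ∀ {t} u v → sign u v ≡ just t → sign⁺ (u , zero) (v , zero) ≡ just t
  sign⁺-outer u v e with u ≟ᵛ v
  ... | no  _    = e
  ... | yes refl = trans (sym (sign-irrefl u)) e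

  sign⁺-sym : ∀ x y → sign⁺ x y ≡ sign⁺ y x
  sign⁺-sym (u , i) (v , j) with u ≟ᵛ v | v ≟ᵛ u
  ... | yes _   | yes _   = fan-sym s i j
  ... | yes u≡v | no  v≢u = contradiction (sym u≡v) v≢u
  ... | no  u≢v | yes v≡u = contradiction (sym v≡u) u≢v
  sign⁺-sym (u , zero)  (v , zero)  | no _ | no _ = sign-sym u v
  sign⁺-sym (u , zero)  (v , suc _) | no _ | no _ = refl
  sign⁺-sym (u , suc _) (v , zero)  | no _ | no _ = refl
  sign⁺-sym (u , suc _) (v , suc _) | no _ | no _ = refl

  -- Lexicographic order: the fan at v fills a block of consecutive labels, apex first.
  label⁺ : Vertex⁺ → ℕ
  label⁺ (v , i) = label v ℕ.* suc m ℕ.+ toℕ i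

  label⁺-≤ : ∀ x y → label⁺ x ℕ.≤ label⁺ y → label (proj₁ x) ℕ.≤ label (proj₁ y)
  label⁺-≤ (u , i) (v , j) x≤y = ℕ.≤-pred (ℕ.*-cancelʳ-< (suc m) (label u) (suc (label v)) (begin-strict
    label u ℕ.* suc m             ≤⟨ ℕ.m≤m+n _ (toℕ i) ⟩
    label⁺ (u , i)                ≤⟨ x≤y ⟩
    label v ℕ.* suc m ℕ.+ toℕ j   <⟨ ℕ.+-monoʳ-< (label v ℕ.* suc m) (Fin.toℕ<n j) ⟩
    label v ℕ.* suc m ℕ.+ suc m   ≡⟨ ℕ.+-comm (label v ℕ.* suc m) (suc m) ⟩
    suc (label v) ℕ.* suc m       ∎))
    where open ℕ.≤-Reasoning

  label⁺-<-apex : ∀ x v → label⁺ x ℕ.< label⁺ (v , zero) → label (proj₁ x) ℕ.< label v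
  label⁺-<-apex (u , i) v x<v = ℕ.*-cancelʳ-< (suc m) (label u) (label v) (begin-strict
    label u ℕ.* suc m     ≤⟨ ℕ.m≤m+n _ (toℕ i) ⟩
    label⁺ (u , i)        <⟨ x<v ⟩
    label⁺ (v , zero)     ≡⟨ ℕ.+-identityʳ _ ⟩
    label v ℕ.* suc m     ∎)
    where open ℕ.≤-Reasoning

  label⁺-<-inner : ∀ {u i j} → label⁺ (u , i) ℕ.< label⁺ (u , j) → toℕ i ℕ.< toℕ j
  label⁺-<-inner {u} = ℕ.+-cancelˡ-< (label u ℕ.* suc m) _ _

  label⁺-injective : ∀ {x y} → label⁺ x ≡ label⁺ y → x ≡ y
  label⁺-injective {u , i} {v , j} e
    with label-injective (ℕ.≤-antisym (label⁺-≤ (u , i) (v , j) (ℕ.≤-reflexive e))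
                                      (label⁺-≤ (v , j) (u , i) (ℕ.≤-reflexive (sym e))))
  ... | refl = cong (u ,_) (Fin.toℕ-injective (ℕ.+-cancelˡ-≡ (label u ℕ.* suc m) _ _ e))

  block-between : ∀ x y z → proj₁ x ≡ proj₁ z → label⁺ x ℕ.< label⁺ y → label⁺ y ℕ.< label⁺ z →
                  proj₁ y ≡ proj₁ z
  block-between x y z refl x<y y<z = label-injective (ℕ.≤-antisym
    (label⁺-≤ y z (ℕ.<⇒≤ y<z)) (label⁺-≤ x y (ℕ.<⇒≤ x<y)))

  -- An edge within a fan traps w in its own block, so the other edge either lies in the same fan or
  -- starts at the apex, which nothing in the block precedes. If only the second edge lies within a
  -- fan, the apex y would fall strictly inside the block of w and z. Two old edges reduce to the
  -- given diagram.
  non-crossing⁺ : ∀ {t r x y w z} → Edge⁺ t x y → Edge⁺ r w z →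
                  label⁺ x ℕ.< label⁺ w → label⁺ w ℕ.< label⁺ y → label⁺ y ℕ.< label⁺ z → ⊥
  non-crossing⁺ {x = x} {y} {w} {z} (inner e) f x<w w<y y<z
    with block-between x w y refl x<w w<y
  non-crossing⁺ (inner e) (inner f) x<w w<y y<z | refl =
    fan-non-crossing _ _ _ _ e f (label⁺-<-inner x<w) (label⁺-<-inner w<y) (label⁺-<-inner y<z)
  non-crossing⁺ (inner e) (outer f) x<w w<y y<z | refl =
    contradiction (label⁺-<-inner x<w) λ ()
  non-crossing⁺ {w = w} {z} (outer {v = v} e) (inner f) x<w w<y y<z =
    ℕ.<⇒≱ (label⁺-<-apex w v w<y) (label⁺-≤ (v , zero) z (ℕ.<⇒≤ y<z))
  non-crossing⁺ (outer {u} {v} e) (outer {w} {z} f) x<w w<y y<z =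
    non-crossing e f (label⁺-<-apex _ w x<w) (label⁺-<-apex _ v w<y) (label⁺-<-apex _ z y<z)

  attachFans : ChordDiagram
  attachFans = record
    { Vertex          = Vertex⁺
    ; order           = order ℕ.* suc m
    ; finite          = ↔-trans (finite ×-↔ ↔-refl) (↔-sym Fin.*↔×)
    ; label           = label⁺
    ; label-injective = label⁺-injective
    ; sign            = sign⁺
    ; sign-sym        = sign⁺-sym
    ; sign-irrefl     = λ (u , i) → trans (sign⁺-inner u i i) (fan-irrefl s i)
    ; non-crossing    = λ e f → non-crossing⁺ (view _ _ e) (view _ _ f)
    }

open AttachFans using (attachFans; sign⁺-inner; sign⁺-outer)

-- Alternating walks, cores and discarding vertices

every-sign : ∀ {P : Sign → Set} s → P s → P (opposite s) → ∀ t → P t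
every-sign Sign.+ p q Sign.+ = p
every-sign Sign.+ p q Sign.- = q
every-sign Sign.- p q Sign.+ = q
every-sign Sign.- p q Sign.- = p

by-signs : ∀ {P Q : Sign → Set} → (∀ s → P s ⊎ Q s) → (∀ s → P s) ⊎ (∃[ s ] Q s)
by-signs d with d Sign.+ | d Sign.-
... | inj₂ q | _      = inj₂ (Sign.+ , q)
... | inj₁ _ | inj₂ q = inj₂ (Sign.- , q)
... | inj₁ p | inj₁ q = inj₁ (every-sign Sign.+ p q)

module _ {V : Set} (_≟_ : DecidableEquality V) where

  remove : V → List V → List V
  remove x = filter (λ y → ¬? (y ≟ x))

  remove-length : ∀ {x ys} → x ∈ ys → length (remove x ys) ℕ.< length ys
  remove-length {x} {ys} x∈ys =
    filter-notAll (λ y → ¬? (y ≟ x)) ys (Any.map (λ x≡y y≢x → y≢x (sym x≡y)) x∈ys)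

  ∈-remove⁺ : ∀ {x y ys} → y ∈ ys → y ≢ x → y ∈ remove x ys
  ∈-remove⁺ {x} = ∈-filter⁺ (λ y → ¬? (y ≟ x))

  ∈-remove⁻ : ∀ {x y ys} → y ∈ remove x ys → y ∈ ys
  ∈-remove⁻ {x} {ys = ys} y∈ = proj₁ (∈-filter⁻ (λ y → ¬? (y ≟ x)) {xs = ys} y∈)

module Signed {V : Set} (_≟_ : DecidableEquality V)
  (E : Sign → V → V → Set) (E? : ∀ s → Decidable (E s))
  (E-sym : ∀ {s u v} → E s u v → E s v u) where

  record Core (ys : List V) : Set where
    field
      members  : List V
      sub      : ∀ {x} → x ∈ members → x ∈ ys
      point    : V
      point∈   : point ∈ members
      closed   : ∀ {x} → x ∈ members → ∀ s → ∃[ y ] y ∈ members × E s x y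

  data Walk (ys : List V) : Sign → ℕ → V → Set where
    stop : ∀ {s u} → u ∈ ys → Walk ys s 0 u
    step : ∀ {s k u v} → u ∈ ys → E s u v → Walk ys (opposite s) k v → Walk ys s (suc k) u

  start∈ : ∀ {ys s k u} → Walk ys s k u → u ∈ ys
  start∈ (stop u∈)     = u∈
  start∈ (step u∈ _ _) = u∈

  -- A vertex without neighbours of one of the signs can only be an end of an
  -- alternating walk.
  module _ {ys x t} (¬t : ¬ Any (E t x) ys) where

    interior : ∀ {s u v w} → u ∈ ys → E s v u → v ∈ ys → E (opposite s) u w → w ∈ ys →
               u ∈ remove _≟_ x ys
    interior {s} {u} u∈ vu v∈ uw w∈ = ∈-remove⁺ _≟_ u∈ λ { refl →
      ¬t (every-sign {λ t → Any (E t u) ys} s (lose v∈ (E-sym vu)) (lose w∈ uw) t) }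

    trim : ∀ {s k u v} → v ∈ ys → E s v u → Walk ys (opposite s) (suc k) u →
           Walk (remove _≟_ x ys) (opposite s) k u
    trim {k = zero}  v∈ vu (step u∈ uw (stop w∈)) = stop (interior u∈ vu v∈ uw w∈)
    trim {k = suc k} v∈ vu (step u∈ uw walk)      =
      step (interior u∈ vu v∈ uw (start∈ walk)) uw (trim u∈ uw walk)

  -- If `ys` is not itself a core, some vertex lacks neighbours of one sign and is removed. By
  -- `trim` a walk survives the removal once its first and last edges are cut off; hence two edges
  -- per vertex in the bound.
  core-or-no-walk : ∀ k ys → length ys ℕ.≤ k → Core ys ⊎ (∀ {s u} → ¬ Walk ys s (k ℕ.+ k) u)
  core-or-no-walk k [] _ = inj₂ λ walk → case start∈ walk of λ ()
  core-or-no-walk (suc k) ys@(y ∷ _) len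
    with All.decide {P = λ x → ∀ s → Any (E s x) ys} {Q = λ x → ∃[ s ] ¬ Any (E s x) ys}
                    (λ x → by-signs λ s → has s x) ys
    where
    has : ∀ s x → Any (E s x) ys ⊎ ¬ Any (E s x) ys
    has s x with Any.any? (E? s x) ys
    ... | yes a = inj₁ a
    ... | no ¬a = inj₂ ¬a
  ... | inj₁ all = inj₁ record
    { members = ys
    ; sub     = λ x∈ → x∈
    ; point   = y
    ; point∈  = here refl
    ; closed  = λ x∈ s → find (All.lookup all x∈ s)
    }
  ... | inj₂ any with find any
  ...   | x , x∈ , t , ¬t
    with core-or-no-walk k (remove _≟_ x ys) (ℕ.≤-pred (ℕ.≤-trans (remove-length _≟_ x∈) len))
  ...     | inj₁ core = inj₁ record
    { Core core hiding (sub)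
    ; sub = λ z∈ → ∈-remove⁻ _≟_ (Core.sub core z∈)
    }
  ...     | inj₂ none = inj₂ λ
    { (step {s} {v = v} u∈ uv walk) →
        none (trim ¬t u∈ uv (subst (λ n → Walk ys (opposite s) n v) (ℕ.+-suc k k) walk)) }

  record Target (xs : List V) (D : ChordDiagram) : Set where
    open ChordDiagram D
    field
      map      : Vertex → V
      map-edge : ∀ {u v s} → sign u v ≡ just s → E s (map u) (map v)
      map∈     : ∀ u → map u ∈ xs

  nbhd : Sign → V → List V → List V
  nbhd s x = filter (E? s x)

  alternating-walk : ∀ {ys} s k (h : Fin (suc k) → V) → (∀ i → h i ∈ ys) →
    (∀ {i j t} → alternating s i j ≡ just t → E t (h i) (h j)) → Walk ys s k (h zero)
  alternating-walk s zero    h h∈ edge = stop (h∈ zero)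
  alternating-walk s (suc k) h h∈ edge = step (h∈ zero) (edge {zero} {suc zero} refl)
    (alternating-walk (opposite s) k (λ i → h (suc i)) (λ i → h∈ (suc i)) (λ {i} {j} → edge {suc i} {suc j}))

  -- The map for `D` with fans attached is restricted to the apexes. An apex sent to x would carry
  -- its path, with `suc k` vertices and so k edges, to a walk among the s-neighbours of x.
  avoid : ∀ {xs x s k} → (∀ {t u} → ¬ Walk (nbhd s x xs) t k u) →
          (∀ D → Target xs D) → ∀ D → Target (remove _≟_ x xs) D
  avoid {xs} {x} {s} {k} none target D = record
    { map      = f
    ; map-edge = λ {u} {v} e → map-edge (sign⁺-outer D s (suc k) u v e)
    ; map∈     = λ u → ∈-remove⁺ _≟_ (map∈ (u , zero)) λ fu≡x → none (walk u fu≡x)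
    }
    where
    open Target (target (attachFans D s (suc k)))
    f = λ u → map (u , zero)

    walk : ∀ u → f u ≡ x → Walk (nbhd s x xs) Sign.+ k (map (u , suc zero))
    walk u refl = alternating-walk Sign.+ k (λ i → map (u , suc i))
      (λ i → ∈-filter⁺ (E? s x) (map∈ (u , suc i))
               (map-edge (sign⁺-inner D s (suc k) u zero (suc i))))
      (λ {i} {j} e → map-edge (trans (sign⁺-inner D s (suc k) u (suc i) (suc j)) e))

  record StableCore : Set where
    field
      members : List V
      point   : V
      point∈  : point ∈ members
      stable  : ∀ {x} → x ∈ members → ∀ s → Core (nbhd s x members)

  -- By `avoid` the shorter list still receives every diagram, so discarding can be repeated; it
  -- stops at a nonempty list because `singleton` always has an image.
  stable-core : ∀ k xs → length xs ℕ.≤ k → (∀ D → Target xs D) → StableCore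
  stable-core k xs len target
    with All.decide {P = λ x → ∀ s → Core (nbhd s x xs)}
           {Q = λ x → ∃[ s ] (∀ {t u} → ¬ Walk (nbhd s x xs) t _ u)}
           (λ x → by-signs λ s → core-or-no-walk _ (nbhd s x xs) ℕ.≤-refl) xs
  ... | inj₁ all = record
    { members = xs
    ; point   = Target.map (target singleton) zero
    ; point∈  = Target.map∈ (target singleton) zero
    ; stable  = All.lookup all
    }
  stable-core zero    []  len target | inj₂ ()
  stable-core (suc k) xs  len target | inj₂ any with find any
  ... | x , x∈ , s , none =
    stable-core k (remove _≟_ x xs) (ℕ.≤-pred (ℕ.≤-trans (remove-length _≟_ x∈) len))
      (avoid none target)

  module _ (E-irrefl : ∀ {s u} → ¬ E s u u)
           (E-disjoint : ∀ {u v} → E Sign.+ u v → ¬ E Sign.- u v) where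

    ≢-irrefl : ∀ {s u v} → E s u v → u ≢ v
    ≢-irrefl e refl = E-irrefl e

    ≢-signs : ∀ {u v w} → E Sign.+ u v → E Sign.- u w → v ≢ w
    ≢-signs e f refl = E-disjoint e f

    -- Take a with a positive neighbour p and a negative neighbour n. A negative neighbour q of p is
    -- a fourth vertex unless q = n. In that case n is joined negatively to both a and p, and a
    -- positive neighbour r of n is the fourth.
    core-four : ∀ {ys} (c : Core ys) →
      ∃[ xs ] length xs ≡ 4 × Unique xs × All (_∈ Core.members c) xs
    core-four c
      with closed point∈ Sign.+ | closed point∈ Sign.-
      where open Core c
    ... | p , p∈ , ap | n , n∈ , an
      with Core.closed c p∈ Sign.- | Core.closed c n∈ Sign.+
    ... | q , q∈ , pq | r , r∈ , nr with q ≟ n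
    ... | no q≢n =
        a ∷ p ∷ n ∷ q ∷ [] , refl
      , (≢-irrefl ap ∷ ≢-irrefl an ∷ ≢-signs (E-sym ap) pq ∷ [])
      ∷ (≢-signs ap an ∷ ≢-irrefl pq ∷ [])
      ∷ ((λ n≡q → q≢n (sym n≡q)) ∷ [])
      ∷ [] ∷ []
      , Core.point∈ c ∷ p∈ ∷ n∈ ∷ q∈ ∷ []
      where a = Core.point c
    ... | yes refl =
        a ∷ p ∷ n ∷ r ∷ [] , refl
      , (≢-irrefl ap ∷ ≢-irrefl an ∷ ≢-sym (≢-signs nr (E-sym an)) ∷ [])
      ∷ (≢-signs ap an ∷ ≢-sym (≢-signs nr (E-sym pq)) ∷ [])
      ∷ (≢-irrefl nr ∷ [])
      ∷ [] ∷ []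
      , Core.point∈ c ∷ p∈ ∷ n∈ ∷ r∈ ∷ []
      where a = Core.point c

-- Counting common neighbours

δ : ∀ {n} → Fin n → Fin n → ℕ
δ zero    zero    = 1
δ zero    (suc _) = 0
δ (suc _) zero    = 0
δ (suc i) (suc j) = δ i j

δ-refl : ∀ {n} (i : Fin n) → δ i i ≡ 1
δ-refl zero    = refl
δ-refl (suc i) = δ-refl i

δ-≢ : ∀ {n} {i j : Fin n} → i ≢ j → δ i j ≡ 0
δ-≢ {i = zero}  {zero}  i≢j = contradiction refl i≢j
δ-≢ {i = zero}  {suc _} i≢j = refl
δ-≢ {i = suc _} {zero}  i≢j = refl
δ-≢ {i = suc _} {suc _} i≢j = δ-≢ λ i≡j → i≢j (cong suc i≡j)

sum-zero : ∀ {n} (f : Fin n → ℕ) → (∀ i → f i ≡ 0) → sum f ≡ 0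
sum-zero {zero}  f f≡0 = refl
sum-zero {suc n} f f≡0 = cong₂ _+_ (f≡0 zero) (sum-zero (λ i → f (suc i)) λ i → f≡0 (suc i))

sum-δ : ∀ {n} (f : Fin n → ℕ) i → sum (λ j → f j * δ i j) ≡ f i
sum-δ f zero    = trans
  (cong₂ _+_ (ℕ.*-identityʳ (f zero)) (sum-zero _ λ j → ℕ.*-zeroʳ (f (suc j))))
  (ℕ.+-identityʳ (f zero))
sum-δ f (suc i) = cong₂ _+_ (ℕ.*-zeroʳ (f zero)) (sum-δ (λ j → f (suc j)) i)

sum-δ≡1 : ∀ {n} (i : Fin n) → sum (δ i) ≡ 1
sum-δ≡1 i = trans (sum-cong-≗ λ j → sym (ℕ.*-identityˡ (δ i j))) (sum-δ (λ _ → 1) i)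

sum-mono : ∀ {n} {f g : Fin n → ℕ} → (∀ i → f i ≤ g i) → sum f ≤ sum g
sum-mono {zero}  f≤g = z≤n
sum-mono {suc n} f≤g = ℕ.+-mono-≤ (f≤g zero) (sum-mono λ i → f≤g (suc i))

-- A strict inequality at one index could not be made up for at the others.
sum-tight : ∀ {n} {f g : Fin n → ℕ} → (∀ i → f i ≤ g i) → sum g ≤ sum f → ∀ i → g i ≤ f i
sum-tight {suc n} {f} {g} f≤g Σg≤Σf zero = ℕ.+-cancelʳ-≤ (sum λ i → g (suc i)) (g zero) (f zero)
  (ℕ.≤-trans Σg≤Σf (ℕ.+-monoʳ-≤ (f zero) (sum-mono λ i → f≤g (suc i))))
sum-tight {suc n} {f} {g} f≤g Σg≤Σf (suc i) = sum-tight (λ j → f≤g (suc j))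
  (ℕ.+-cancelˡ-≤ (g zero) _ _ (ℕ.≤-trans Σg≤Σf (ℕ.+-monoˡ-≤ _ (f≤g zero)))) i

multiplicity : ∀ {n} → List (Fin n) → Fin n → ℕ
multiplicity []       w = 0
multiplicity (x ∷ xs) w = δ x w + multiplicity xs w

multiplicity-∉ : ∀ {n} {w : Fin n} {xs} → All (w ≢_) xs → multiplicity xs w ≡ 0
multiplicity-∉ []             = refl
multiplicity-∉ (w≢x ∷ w≢xs) = cong₂ _+_ (δ-≢ (≢-sym w≢x)) (multiplicity-∉ w≢xs)

sum-multiplicity : ∀ {n} (xs : List (Fin n)) → sum (multiplicity xs) ≡ length xs
sum-multiplicity {n} []   = sum-zero {n} (multiplicity []) λ _ → refl
sum-multiplicity (x ∷ xs) = trans (∑-distrib-+ (δ x) (multiplicity xs))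
  (cong₂ _+_ (sum-δ≡1 x) (sum-multiplicity xs))

multiplicity-≤ : ∀ {n} {f : Fin n → ℕ} {xs} → Unique xs → All (λ x → f x ≡ 1) xs →
                 ∀ w → multiplicity xs w ≤ f w
multiplicity-≤ []            []         w = z≤n
multiplicity-≤ {xs = x ∷ xs} (x≢ ∷ uniq) (fx≡1 ∷ f≡1) w with x Fin.≟ w
... | yes refl = ℕ.≤-reflexive (trans (cong₂ _+_ (δ-refl x) (multiplicity-∉ x≢)) (sym fx≡1))
... | no  x≢w  = subst (λ d → d + multiplicity xs w ≤ _) (sym (δ-≢ x≢w)) (multiplicity-≤ uniq f≡1 w)

-- The source of all lower bounds on counts, and the pigeonhole principle when the sum is known:
-- without repetitions, `multiplicity xs` stays below f.
length≤sum : ∀ {n} {f : Fin n → ℕ} {xs} → Unique xs → All (λ x → f x ≡ 1) xs → length xs ≤ sum f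
length≤sum {xs = xs} uniq f≡1 =
  subst (_≤ _) (sum-multiplicity xs) (sum-mono (multiplicity-≤ uniq f≡1))

indicator : ∀ {P : Set} → Dec P → ℕ
indicator d = if does d then 1 else 0

indicator-true : ∀ {P : Set} (d : Dec P) → P → indicator d ≡ 1
indicator-true (yes _) p = refl
indicator-true (no ¬p) p = contradiction p ¬p

indicator-false : ∀ {P : Set} (d : Dec P) → ¬ P → indicator d ≡ 0
indicator-false (yes p) ¬p = contradiction p ¬p
indicator-false (no _)  ¬p = refl

indicator-idem : ∀ {P : Set} (d : Dec P) → indicator d * indicator d ≡ indicator d
indicator-idem (yes _) = refl
indicator-idem (no _)  = refl

indicator-cong : ∀ {P Q : Set} (d : Dec P) (e : Dec Q) → (P → Q) → (Q → P) → indicator d ≡ indicator e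
indicator-cong (yes p) e to from = sym (indicator-true e (to p))
indicator-cong (no ¬p) e to from = sym (indicator-false e λ q → ¬p (from q))

indicator-≤ : ∀ {P : Set} (d : Dec P) {m} → (P → 1 ≤ m) → indicator d ≤ m
indicator-≤ (yes p) h = h p
indicator-≤ (no _)  h = z≤n

-- Signed graphs on nine vertices: tightness and counting

module Nine (E : Sign → Fin 9 → Fin 9 → Set) (E? : ∀ s → Decidable (E s))
  (E-sym : ∀ {s u v} → E s u v → E s v u)
  (E-irrefl : ∀ {s u} → ¬ E s u u) (E-disjoint : ∀ {u v} → E Sign.+ u v → ¬ E Sign.- u v)
  where

  open Signed Fin._≟_ E E? E-sym

  -- The consequences of equality in 1 + 4 + 4 = 9. For t = s, `closed` provides a common
  -- s-neighbour of the ends of an s-edge.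
  record Tight : Set where
    field
      total   : ∀ u v → u ≡ v ⊎ (∃[ s ] E s u v)
      closed  : ∀ {s x u} → E s x u → ∀ t → ∃[ w ] E s x w × E t u w
      degree≥ : ∀ s u → 4 ≤ sum (λ w → indicator (E? s u w))

  opposite-disjoint : ∀ {u v} s → E s u v → ¬ E (opposite s) u v
  opposite-disjoint Sign.+ e f = E-disjoint e f
  opposite-disjoint Sign.- e f = E-disjoint f e

  tight : StableCore → Tight
  tight c = record { total = total ; closed = closed ; degree≥ = degree≥ }
    where
    module C = StableCore c

    module At {x} (x∈ : x ∈ C.members) where

      core : ∀ s → Core (nbhd s x C.members)
      core s = C.stable x∈ s

      four : ∀ s → ∃[ xs ] length xs ≡ 4 × Unique xs × All (_∈ Core.members (core s)) xs
      four s = core-four E-irrefl E-disjoint (core s)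

      core⇒nbhd : ∀ s {y} → y ∈ Core.members (core s) → y ∈ C.members × E s x y
      core⇒nbhd s y∈ = ∈-filter⁻ (E? s x) {xs = C.members} (Core.sub (core s) y∈)

      fours : List (Fin 9)
      fours = proj₁ (four Sign.+) ++ proj₁ (four Sign.-)

      in-four : ∀ s {y} → y ∈ proj₁ (four s) → y ∈ Core.members (core s)
      in-four s y∈ = All.lookup (proj₂ (proj₂ (proj₂ (four s)))) y∈

      ∈-fours : ∀ {y} → y ∈ fours → ∃[ s ] y ∈ Core.members (core s)
      ∈-fours y∈ with ∈-++⁻ (proj₁ (four Sign.+)) y∈
      ... | inj₁ y∈₊ = Sign.+ , in-four Sign.+ y∈₊
      ... | inj₂ y∈₋ = Sign.- , in-four Sign.- y∈₋

      fours-unique : Unique fours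
      fours-unique = ++⁺ (proj₁ (proj₂ (proj₂ (four Sign.+)))) (proj₁ (proj₂ (proj₂ (four Sign.-))))
        λ (y∈₊ , y∈₋) → E-disjoint (proj₂ (core⇒nbhd Sign.+ (in-four Sign.+ y∈₊)))
                                     (proj₂ (core⇒nbhd Sign.- (in-four Sign.- y∈₋)))

      everything : ∀ y → y ≡ x ⊎ (∃[ s ] y ∈ Core.members (core s))
      everything y with y Fin.≟ x | Any.any? (y Fin.≟_) fours
      ... | yes y≡x | _       = inj₁ y≡x
      ... | no _    | yes y∈  = inj₂ (∈-fours y∈)
      -- Otherwise y, x and the eight vertices of `fours` would be ten distinct vertices.
      ... | no y≢x  | no  y∉  = contradiction
        (length≤sum {f = λ _ → 1} {y ∷ x ∷ fours}
          ((y≢x ∷ All.¬Any⇒All¬ fours y∉) ∷ All.tabulate x≢ ∷ fours-unique)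
          (All.tabulate λ _ → refl))
        (subst (λ l → ¬ (suc (suc l) ≤ 9)) (sym length-fours) (ℕ.1+n≰n {9}))
        where
        x≢ : ∀ {z} → z ∈ fours → x ≢ z
        x≢ z∈ refl with ∈-fours z∈
        ... | s , z∈core = E-irrefl (proj₂ (core⇒nbhd s z∈core))
        length-fours : length fours ≡ 8
        length-fours = trans (length-++ (proj₁ (four Sign.+)))
          (cong₂ _+_ (proj₁ (proj₂ (four Sign.+))) (proj₁ (proj₂ (four Sign.-))))

    all∈ : ∀ y → y ∈ C.members
    all∈ y with At.everything C.point∈ y
    ... | inj₁ refl     = C.point∈
    ... | inj₂ (s , y∈) = proj₁ (At.core⇒nbhd C.point∈ s y∈)

    total : ∀ u v → u ≡ v ⊎ (∃[ s ] E s u v)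
    total u v with At.everything (all∈ u) v
    ... | inj₁ v≡u      = inj₁ (sym v≡u)
    ... | inj₂ (s , v∈) = inj₂ (s , proj₂ (At.core⇒nbhd (all∈ u) s v∈))

    -- The two cores at x cover all other vertices, and u cannot lie in the core of the other sign.
    -- So each core is a full neighbourhood, and its closure property passes to the neighbourhood.
    nbr∈core : ∀ {x u} s → E s x u → u ∈ Core.members (At.core (all∈ x) s)
    nbr∈core {x} {u} s e with At.everything (all∈ x) u
    ... | inj₁ refl = contradiction e E-irrefl
    nbr∈core Sign.+ e | inj₂ (Sign.+ , u∈) = u∈
    nbr∈core Sign.- e | inj₂ (Sign.- , u∈) = u∈
    nbr∈core Sign.+ e | inj₂ (Sign.- , u∈) =
      contradiction (proj₂ (At.core⇒nbhd (all∈ _) Sign.- u∈)) (E-disjoint e)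
    nbr∈core Sign.- e | inj₂ (Sign.+ , u∈) =
      contradiction e (E-disjoint (proj₂ (At.core⇒nbhd (all∈ _) Sign.+ u∈)))

    closed : ∀ {s x u} → E s x u → ∀ t → ∃[ w ] E s x w × E t u w
    closed {s} {x} e t with Core.closed (At.core (all∈ x) s) (nbr∈core s e) t
    ... | w , w∈ , uw = w , proj₂ (At.core⇒nbhd (all∈ x) s w∈) , uw

    degree≥ : ∀ s u → 4 ≤ sum (λ w → indicator (E? s u w))
    degree≥ s u with At.four (all∈ u) s
    ... | xs , len , uniq , xs∈ = subst (_≤ _) len (length≤sum uniq
      (All.map (λ y∈ → indicator-true (E? s u _) (proj₂ (At.core⇒nbhd (all∈ u) s y∈))) xs∈))

  module Counting (T : Tight) where
    open Tight T
    open ≡-Reasoning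

    p : Sign → Fin 9 → Fin 9 → ℕ
    p s u w = indicator (E? s u w)

    p-sym : ∀ s u v → p s u v ≡ p s v u
    p-sym s u v = indicator-cong (E? s u v) (E? s v u) E-sym E-sym

    p-true : ∀ {s u v} → E s u v → p s u v ≡ 1
    p-true {s} {u} {v} = indicator-true (E? s u v)

    p-false : ∀ {s u v} → ¬ E s u v → p s u v ≡ 0
    p-false {s} {u} {v} = indicator-false (E? s u v)

    partition : ∀ s u v → p s u v + p (opposite s) u v + δ u v ≡ 1
    partition s u v with total u v
    ... | inj₁ refl = cong₂ _+_ (cong₂ _+_ (p-false E-irrefl) (p-false E-irrefl)) (δ-refl u)
    ... | inj₂ (t , e) = trans
      (cong (p s u v + p (opposite s) u v +_) (δ-≢ {i = u} {v} λ { refl → E-irrefl e }))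
      (trans (ℕ.+-identityʳ _) (sides s t e))
      where
      sides : ∀ s t → E t u v → p s u v + p (opposite s) u v ≡ 1
      sides Sign.+ Sign.+ e = cong₂ _+_ (p-true e) (p-false (E-disjoint e))
      sides Sign.+ Sign.- e = cong₂ _+_ (p-false λ f → E-disjoint f e) (p-true e)
      sides Sign.- Sign.+ e = cong₂ _+_ (p-false (E-disjoint e)) (p-true e)
      sides Sign.- Sign.- e = cong₂ _+_ (p-true e) (p-false λ f → E-disjoint f e)

    sum-split : ∀ s v (f : Fin 9 → ℕ) →
      sum f ≡ sum (λ w → f w * p s v w) + sum (λ w → f w * p (opposite s) v w) + f v
    sum-split s v f = begin
      sum f
        ≡⟨ sum-cong-≗ pointwise ⟩
      sum (λ w → f w * p s v w + f w * p (opposite s) v w + f w * δ v w)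
        ≡⟨ ∑-distrib-+ (λ w → f w * p s v w + f w * p (opposite s) v w) (λ w → f w * δ v w) ⟩
      sum (λ w → f w * p s v w + f w * p (opposite s) v w) + sum (λ w → f w * δ v w)
        ≡⟨ cong₂ _+_ (∑-distrib-+ (λ w → f w * p s v w) (λ w → f w * p (opposite s) v w)) (sum-δ f v) ⟩
      sum (λ w → f w * p s v w) + sum (λ w → f w * p (opposite s) v w) + f v
        ∎
      where
      pointwise : ∀ w → f w ≡ f w * p s v w + f w * p (opposite s) v w + f w * δ v w
      pointwise w = begin
        f w ≡⟨ ℕ.*-identityʳ (f w) ⟨
        f w * 1 ≡⟨ cong (f w *_) (partition s v w) ⟨
        f w * (p s v w + p (opposite s) v w + δ v w) ≡⟨ ℕ.*-distribˡ-+ (f w) _ (δ v w) ⟩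
        f w * (p s v w + p (opposite s) v w) + f w * δ v w
          ≡⟨ cong (_+ f w * δ v w) (ℕ.*-distribˡ-+ (f w) (p s v w) _) ⟩
        f w * p s v w + f w * p (opposite s) v w + f w * δ v w ∎

    -- The two degrees at u add up to 8 and neither is below 4.
    degree : ∀ s u → sum (p s u) ≡ 4
    degree s u = ℕ.≤-antisym (ℕ.+-cancelʳ-≤ 4 _ 4 (ℕ.≤-trans
      (ℕ.+-monoʳ-≤ (sum (p s u)) (degree≥ (opposite s) u))
      (ℕ.≤-reflexive (ℕ.+-cancelʳ-≡ 1 _ 8 (sym total-degree))))) (degree≥ s u)
      where
      total-degree : 9 ≡ sum (p s u) + sum (p (opposite s) u) + 1
      total-degree = trans (sum-split s u (λ _ → 1)) (cong (_+ 1) (cong₂ _+_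
        (sum-cong-≗ λ w → ℕ.*-identityˡ (p s u w)) (sum-cong-≗ λ w → ℕ.*-identityˡ (p (opposite s) u w))))

    common : Sign → Fin 9 → Fin 9 → ℕ
    common s u v = sum λ w → p s u w * p s v w

    -- Two sets of size 4 are compared. The s-neighbours of u, sorted by their relation to v, number
    -- `common s u v + mixed + 1`, the 1 being v itself. The opposite neighbours of v, sorted by
    -- their relation to u, number `mixed + common o u v`, as u is not among them.
    common-opposite : ∀ {s u v} → E s u v → common (opposite s) u v ≡ suc (common s u v)
    common-opposite {s} {u} {v} e = ℕ.+-cancelˡ-≡ mixed _ _ (begin
      mixed + common o u v                ≡⟨ cong₂ _+_ (sum-cong-≗ λ w → ℕ.*-comm (p s u w) (p o v w))
                                                     (sum-cong-≗ λ w → ℕ.*-comm (p o u w) (p o v w)) ⟩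
      row                                 ≡⟨ ℕ.+-identityʳ row ⟨
      row + 0                             ≡⟨ cong (row +_) (p-false λ f → opposite-disjoint s e (E-sym f)) ⟨
      row + p o v u                       ≡⟨ sum-split s u (p o v) ⟨
      sum (p o v)                         ≡⟨ trans (degree o v) (sym (degree s u)) ⟩
      sum (p s u)                         ≡⟨ sum-split s v (p s u) ⟩
      common s u v + mixed + p s u v      ≡⟨ cong (common s u v + mixed +_) (p-true e) ⟩
      common s u v + mixed + 1            ≡⟨ rearrange (common s u v) mixed ⟩
      mixed + suc (common s u v)          ∎)
      where
      o = opposite s
      mixed = sum λ w → p s u w * p o v w
      row = sum (λ w → p o v w * p s u w) + sum (λ w → p o v w * p o u w)
      rearrange : ∀ a b → a + b + 1 ≡ b + suc a
      rearrange = solve 2 (λ a b → a :+ b :+ con 1 := b :+ (con 1 :+ a)) refl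
        where open ℕ-Solver

    common-self : ∀ s v → common s v v ≡ 4
    common-self s v = trans (sum-cong-≗ λ w → indicator-idem (E? s v w)) (degree s v)

    -- Double counting of walks of length two from v: 4 choices of the middle vertex w, then 4 of
    -- the end u, which may be v again.
    common-total : ∀ s v → sum (λ u → common s u v) ≡ 16
    common-total s v = begin
      sum (λ u → common s u v)                          ≡⟨ ∑-comm (λ u w → p s u w * p s v w) ⟩
      sum (λ w → sum (λ u → p s u w * p s v w))         ≡⟨ sum-cong-≗ column ⟩
      sum (λ w → 4 * p s v w)                           ≡⟨ *-distribˡ-sum 4 (p s v) ⟨
      4 * sum (p s v)                                   ≡⟨ cong (4 *_) (degree s v) ⟩
      16                                                ∎
      where
      column : ∀ w → sum (λ u → p s u w * p s v w) ≡ 4 * p s v w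
      column w = trans (sym (*-distribʳ-sum (p s v w) (λ u → p s u w)))
        (cong (_* p s v w) (trans (sum-cong-≗ λ u → p-sym s u w) (degree s w)))

    product-true : ∀ {s u v w} → E s u w → E s v w → p s u w * p s v w ≡ 1
    product-true e f = cong₂ _*_ (p-true e) (p-true f)

    common≥1 : ∀ {s u v} → E s u v → 1 ≤ common s u v
    common≥1 {s} {u} {v} e with closed e s
    ... | w , uw , vw = length≤sum {f = λ w → p s u w * p s v w} {w ∷ []} ([] ∷ []) (product-true uw vw ∷ [])

    agreement : Fin 9 → Fin 9 → ℕ
    agreement u v = common Sign.+ u v + common Sign.- u v

    agreement-edge : ∀ {s u v} → E s u v → agreement u v ≡ suc (common s u v + common s u v)
    agreement-edge {Sign.+} {u} {v} e = trans (cong (common Sign.+ u v +_) (common-opposite e)) (ℕ.+-suc _ _)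
    agreement-edge {Sign.-} {u} {v} e = cong (_+ common Sign.- u v) (common-opposite e)

    -- The agreements with v add up to 32 = 8 + 8 · 3, so none of these lower
    -- bounds is exceeded.
    agreement-≥ : ∀ v u → 3 + 5 * δ v u ≤ agreement u v
    agreement-≥ v u with total u v
    ... | inj₁ refl rewrite δ-refl v | common-self Sign.+ v | common-self Sign.- v = ℕ.≤-refl
    ... | inj₂ (s , e) rewrite δ-≢ {i = v} {u} (λ { refl → E-irrefl e }) | agreement-edge e =
      s≤s (ℕ.+-mono-≤ (common≥1 e) (common≥1 e))

    agreement-≤ : ∀ v u → agreement u v ≤ 3 + 5 * δ v u
    agreement-≤ v = sum-tight (agreement-≥ v) (ℕ.≤-reflexive (begin
      sum (λ u → agreement u v)
        ≡⟨ ∑-distrib-+ (λ u → common Sign.+ u v) (λ u → common Sign.- u v) ⟩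
      sum (λ u → common Sign.+ u v) + sum (λ u → common Sign.- u v)
        ≡⟨ cong₂ _+_ (common-total Sign.+ v) (common-total Sign.- v) ⟩
      -- Here 16 + 16 is rewritten to match the bound: the constant 3 summed over nine vertices,
      -- plus 5 for u = v.
      27 + 5 * 1
        ≡⟨ cong (λ d → 27 + 5 * d) (sum-δ≡1 v) ⟨
      27 + 5 * sum (δ v)
        ≡⟨ cong (27 +_) (*-distribˡ-sum 5 (δ v)) ⟩
      27 + sum (λ u → 5 * δ v u)
        ≡⟨ ∑-distrib-+ (λ _ → 3) (λ u → 5 * δ v u) ⟨
      sum (λ u → 3 + 5 * δ v u)
        ∎))

    -- For distinct ends the agreement is at most 3, and on an s-edge it is 1 plus twice
    -- `common s u v`.
    common≡1 : ∀ {s u v} → E s u v → common s u v ≡ 1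
    common≡1 {s} {u} {v} e = ℕ.≤-antisym (half (ℕ.≤-pred (subst₂ _≤_ (agreement-edge e)
      (cong (λ d → 3 + 5 * d) (δ-≢ {i = v} {u} λ { refl → E-irrefl e })) (agreement-≤ v u)))) (common≥1 e)
      where
      half : ∀ {k} → k + k ≤ 2 → k ≤ 1
      half {zero}        _ = z≤n
      half {suc zero}    _ = s≤s z≤n
      half {suc (suc k)} (s≤s (s≤s h)) = contradiction (subst (_≤ 0) (ℕ.+-suc k (suc k)) h) λ ()

    unique-common : ∀ {s u v w z} → E s u v → E s u w → E s v w → E s u z → E s v z → w ≡ z
    unique-common {s} {u} {v} {w} {z} uv uw vw uz vz with w Fin.≟ z
    ... | yes w≡z = w≡z
    ... | no  w≢z = contradiction
      (length≤sum {f = λ y → p s u y * p s v y} {w ∷ z ∷ []} ((w≢z ∷ []) ∷ [] ∷ []) (product-true uw vw ∷ product-true uz vz ∷ []))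
      (subst (λ c → ¬ 2 ≤ c) (sym (common≡1 uv)) (ℕ.1+n≰n {1}))

    -- The ends of a negative edge have 1 + 1 = 2 common positive neighbours by `common-opposite`;
    -- if z were the only candidate, the count would be bounded by the sum of `δ z`, which is 1.
    second-common : ∀ {u v} → E Sign.- u v → ∀ z → ∃[ w ] w ≢ z × E Sign.+ u w × E Sign.+ v w
    second-common {u} {v} e z
      with Fin.any? (λ w → ¬? (w Fin.≟ z) ×-dec (E? Sign.+ u w ×-dec E? Sign.+ v w))
    ... | yes (w , w≢z , uw , vw) = w , w≢z , uw , vw
    ... | no none = contradiction
      (subst₂ _≤_ (trans (common-opposite e) (cong suc (common≡1 e))) (sum-δ≡1 z) (sum-mono bound))
      (ℕ.1+n≰n {1})
      where
      bound : ∀ w → p Sign.+ u w * p Sign.+ v w ≤ δ z w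
      bound w with w Fin.≟ z | E? Sign.+ u w | E? Sign.+ v w
      ... | yes refl | yes _  | yes _  = ℕ.≤-reflexive (sym (δ-refl z))
      ... | no w≢z   | yes uw | yes vw = contradiction (w , w≢z , uw , vw) none
      ... | _        | no _   | _      = z≤n
      ... | _        | yes _  | no _   = z≤n

    no-five : ∀ {s u a b c d e} → Unique (a ∷ b ∷ c ∷ d ∷ e ∷ []) →
              ¬ All (E s u) (a ∷ b ∷ c ∷ d ∷ e ∷ [])
    no-five {s} {u} uniq all = contradiction (length≤sum uniq (All.map p-true all))
      (subst (λ d → ¬ 5 ≤ d) (sym (degree s u)) (ℕ.1+n≰n {4}))

-- The 3 × 3 grid

-- Punching out a missed value would inject a finite set into a smaller one.
injective⇒surjective : ∀ {n} {f : Fin n → Fin n} → Injective _≡_ _≡_ f → ∀ y → ∃[ x ] f x ≡ y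
injective⇒surjective {suc n} {f} inj y with Fin.any? (λ x → f x Fin.≟ y)
... | yes hit  = hit
... | no  miss = contradiction
  (Fin.injective⇒≤ {f = λ x → punchOut (y≢f x)} λ e → inj (Fin.punchOut-injective (y≢f _) (y≢f _) e))
  ℕ.1+n≰n
  where
  y≢f : ∀ x → y ≢ f x
  y≢f x y≡fx = miss (x , sym y≡fx)

avoiding-0 : ∀ (i : Fin 3) → ∃[ m ] 0F ≢ m × i ≢ m
avoiding-0 0F = 1F , (λ ()) , λ ()
avoiding-0 1F = 2F , (λ ()) , λ ()
avoiding-0 2F = 1F , (λ ()) , λ ()

-- Two tokens on a triangle can reach every placement on distinct corners.
slide : ∀ {R : Fin 3 → Fin 3 → Set} →
  (∀ {i j k} → i ≢ j → i ≢ k → R i j → R i k) →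
  (∀ {i j k} → i ≢ j → k ≢ j → R i j → R k j) →
  R 0F 1F → ∀ {i j} → i ≢ j → R i j
slide moveʳ moveˡ r {i} i≢j with avoiding-0 i
... | m , 0≢m , i≢m = moveʳ i≢m i≢j (moveˡ 0≢m i≢m (moveʳ (λ ()) 0≢m r))

-- The squares of 𝔽₃[i] are 0, ±1 and ±i, which are exactly the elements with a zero coordinate.
square⇒aligned : ∀ x y → Square (y -₉ x) → proj₁ x ≡ proj₁ y ⊎ proj₂ x ≡ proj₂ y
square⇒aligned = from-yes (all₉? λ x → all₉? λ y → square? (y -₉ x) →-dec
  (proj₁ x Fin.≟ proj₁ y ⊎-dec proj₂ x Fin.≟ proj₂ y))

nonsquare⇒skew : ∀ x y → NonSquareDifference x y → proj₁ x ≢ proj₁ y × proj₂ x ≢ proj₂ y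
nonsquare⇒skew = from-yes (all₉? λ x → all₉? λ y → ¬? (square? (y -₉ x)) →-dec
  (¬? (proj₁ x Fin.≟ proj₁ y) ×-dec ¬? (proj₂ x Fin.≟ proj₂ y)))

module Gridding (E : Sign → Fin 9 → Fin 9 → Set) (E? : ∀ s → Decidable (E s))
  (E-sym : ∀ {s u v} → E s u v → E s v u)
  (E-irrefl : ∀ {s u} → ¬ E s u u) (E-disjoint : ∀ {u v} → E Sign.+ u v → ¬ E Sign.- u v)
  (T : Nine.Tight E E? E-sym E-irrefl E-disjoint)
  where

  open Nine.Tight T
  open Nine.Counting E E? E-sym E-irrefl E-disjoint T using (unique-common; second-common; no-five)
  open Signed Fin._≟_ E E? E-sym using (≢-irrefl; ≢-signs)

  P N : Fin 9 → Fin 9 → Set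
  P = E Sign.+
  N = E Sign.-

  distinct : ∀ {s u v} → E s u v → u ≢ v
  distinct = ≢-irrefl E-irrefl E-disjoint

  apart : ∀ {u v w} → P u v → N u w → v ≢ w
  apart = ≢-signs E-irrefl E-disjoint

  negative : ∀ {u v} → u ≢ v → ¬ P u v → N u v
  negative {u} {v} u≢v ¬P with total u v
  ... | inj₁ u≡v          = contradiction u≡v u≢v
  ... | inj₂ (Sign.+ , e) = contradiction e ¬P
  ... | inj₂ (Sign.- , e) = e

  -- If ab′ were positive, the positive edge vb′ would have both a and b as common positive
  -- neighbours.
  far : ∀ {v a b b′} → P v a → P v b → P v b′ → P b b′ → N a b → N a b′
  far va vb vb′ bb′ ab = negative
    (λ { refl → E-disjoint bb′ (E-sym ab) })
    (λ ab′ → distinct ab (unique-common vb′ va (E-sym ab′) vb (E-sym bb′)))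

  -- Two positive triangles sharing v, with negative edges between them: the future row and column
  -- of the grid through v.
  record Cross (v a a′ b b′ : Fin 9) : Set where
    field
      va   : P v a
      va′  : P v a′
      aa′  : P a a′
      vb   : P v b
      vb′  : P v b′
      bb′  : P b b′
      ab   : N a b
      ab′  : N a b′
      a′b  : N a′ b
      a′b′ : N a′ b′

  flip : ∀ {v a a′ b b′} → Cross v a a′ b b′ → Cross v a′ a b b′
  flip c = record
    { va = va′ ; va′ = va ; aa′ = E-sym aa′ ; vb = vb ; vb′ = vb′ ; bb′ = bb′
    ; ab = a′b ; ab′ = a′b′ ; a′b = ab ; a′b′ = ab′ }
    where open Cross c

  transpose : ∀ {v a a′ b b′} → Cross v a a′ b b′ → Cross v b b′ a a′
  transpose c = record
    { va = vb ; va′ = vb′ ; aa′ = bb′ ; vb = va ; vb′ = va′ ; bb′ = aa′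
    ; ab = E-sym ab ; ab′ = E-sym a′b ; a′b = E-sym ab′ ; a′b′ = E-sym a′b′ }
    where open Cross c

  flipᵇ : ∀ {v a a′ b b′} → Cross v a a′ b b′ → Cross v a a′ b′ b
  flipᵇ c = transpose (flip (transpose c))

  some-cross : ∃[ v ] ∃[ a ] ∃[ a′ ] ∃[ b ] ∃[ b′ ] Cross v a a′ b b′
  some-cross with start
    where
    start : ∃[ a ] P 0F a
    start with total 0F 1F
    ... | inj₂ (Sign.+ , e) = 1F , e
    ... | inj₂ (Sign.- , e) with second-common e 0F
    ...   | a , _ , 0a , _ = a , 0a
  -- The positive edge va yields a′, which completes a triangle, and b, joined positively to v but
  -- negatively to a, which starts the second triangle.
  ... | a , va with closed va Sign.+ | closed va Sign.-
  ...   | a′ , va′ , aa′ | b , vb , ab with closed vb Sign.+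
  ...     | b′ , vb′ , bb′ = 0F , a , a′ , b , b′ , record
    { va = va ; va′ = va′ ; aa′ = aa′ ; vb = vb ; vb′ = vb′ ; bb′ = bb′
    ; ab = ab ; ab′ = far va vb vb′ bb′ ab ; a′b = a′b ; a′b′ = far va′ vb vb′ bb′ a′b }
    where
    a′b : N a′ b
    a′b = E-sym (far vb va va′ aa′ (E-sym ab))

  -- The fourth vertex of the grid rectangle spanned by v, a and b.
  record Corner (v a b w : Fin 9) : Set where
    field
      w≢v : w ≢ v
      aw  : P a w
      bw  : P b w

  corner : ∀ {v a b} → N a b → ∃[ w ] Corner v a b w
  corner {v} ab with second-common ab v
  ... | w , w≢v , aw , bw = w , record { w≢v = w≢v ; aw = aw ; bw = bw }

  corner-sym : ∀ {v a b w} → Corner v a b w → Corner v b a w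
  corner-sym c = record { w≢v = w≢v ; aw = bw ; bw = aw }
    where open Corner c

  module _ {v a a′ b b′ w} (c : Cross v a a′ b b′) (k : Corner v a b w) where
    open Cross c
    open Corner k

    -- Were vw positive, w and a′ would both be common positive neighbours of v and a, so w = a′;
    -- but b is joined positively to w and negatively to a′.
    corner-centre : N v w
    corner-centre = negative (≢-sym w≢v) λ vw →
      apart bw (E-sym a′b) (unique-common va vw aw va′ aa′)

    corner-opposite : N a′ w
    corner-opposite = negative (≢-sym (apart bw (E-sym a′b))) λ a′w →
      w≢v (unique-common aa′ aw a′w (E-sym va) (E-sym va′))

  -- The positive edge aw has a common positive neighbour z. If z differed from w′, then v, a′, w,
  -- w′ and z would be five positive neighbours of a, which has only four.
  corners-aligned : ∀ {v a a′ b b′ w w′} → Cross v a a′ b b′ →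
                    Corner v a b w → Corner v a b′ w′ → P w w′
  corners-aligned {v} {a} {a′} {b} {b′} {w} {w′} c k k′ with closed (Corner.aw k) Sign.+
  ... | z , az , wz with z Fin.≟ w′
  ...   | yes refl = wz
  ...   | no  z≢w′ = contradiction
    (E-sym va ∷ aa′ ∷ Corner.aw k ∷ Corner.aw k′ ∷ az ∷ [])
    (no-five
      ( (distinct va′ ∷ distinct vw ∷ distinct vw′ ∷ ≢-sym (apart wz (E-sym vw)) ∷ [])
      ∷ (distinct a′w ∷ distinct a′w′ ∷ ≢-sym (apart wz (E-sym a′w)) ∷ [])
      ∷ (≢-sym (apart (Corner.bw k′) b′w) ∷ distinct wz ∷ [])
      ∷ (≢-sym z≢w′ ∷ [])
      ∷ [] ∷ []))
    where
    open Cross c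
    vw : N v w
    vw = corner-centre c k
    vw′ : N v w′
    vw′ = corner-centre (flipᵇ c) k′
    a′w : N a′ w
    a′w = corner-opposite c k
    a′w′ : N a′ w′
    a′w′ = corner-opposite (flipᵇ c) k′
    b′w : N b′ w
    b′w = corner-opposite (transpose c) (corner-sym k)

  Triangle : (Fin 3 → Fin 9) → Set
  Triangle f = P (f 0F) (f 1F) × P (f 1F) (f 2F) × P (f 0F) (f 2F)

  triangle : ∀ {f} → Triangle f → ∀ {i k} → i ≢ k → P (f i) (f k)
  triangle (p , q , r) {0F} {0F} i≢k = contradiction refl i≢k
  triangle (p , q , r) {0F} {1F} i≢k = p
  triangle (p , q , r) {0F} {2F} i≢k = r
  triangle (p , q , r) {1F} {0F} i≢k = E-sym p
  triangle (p , q , r) {1F} {1F} i≢k = contradiction refl i≢k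
  triangle (p , q , r) {1F} {2F} i≢k = q
  triangle (p , q , r) {2F} {0F} i≢k = E-sym r
  triangle (p , q , r) {2F} {1F} i≢k = E-sym q
  triangle (p , q , r) {2F} {2F} i≢k = contradiction refl i≢k

  -- Besides the lines, one negative pair is recorded; `all-skew` spreads it to all pairs that share
  -- no line.
  record Grid : Set where
    field
      g    : 𝔽₉ → Fin 9
      rows : ∀ j → Triangle (λ i → g (i , j))
      cols : ∀ i → Triangle (λ j → g (i , j))
      skew : N (g (0F , 0F)) (g (1F , 1F))

  grid : Grid
  grid with some-cross
  ... | v , a , a′ , b , b′ , c
    with corner (Cross.ab c) | corner (Cross.ab′ c) | corner (Cross.a′b c) | corner (Cross.a′b′ c)
  ... | w₁₁ , k₁₁ | w₁₂ , k₁₂ | w₂₁ , k₂₁ | w₂₂ , k₂₂ = record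
    { g    = g
    ; rows = λ where
        0F → va , aa′ , va′
        1F → Corner.bw k₁₁ , corners-aligned cᵀ (corner-sym k₁₁) (corner-sym k₂₁) , Corner.bw k₂₁
        2F → Corner.bw k₁₂ , corners-aligned (flip cᵀ) (corner-sym k₁₂) (corner-sym k₂₂) , Corner.bw k₂₂
    ; cols = λ where
        0F → vb , bb′ , vb′
        1F → Corner.aw k₁₁ , corners-aligned c k₁₁ k₁₂ , Corner.aw k₁₂
        2F → Corner.aw k₂₁ , corners-aligned (flip c) k₂₁ k₂₂ , Corner.aw k₂₂
    ; skew = corner-centre c k₁₁
    }
    where
    open Cross c
    cᵀ = transpose c
    g : 𝔽₉ → Fin 9
    g (0F , 0F) = v
    g (1F , 0F) = a
    g (2F , 0F) = a′
    g (0F , 1F) = b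
    g (0F , 2F) = b′
    g (1F , 1F) = w₁₁
    g (1F , 2F) = w₁₂
    g (2F , 1F) = w₂₁
    g (2F , 2F) = w₂₂

  module GridProperties (G : Grid) where
    open Grid G

    row : ∀ j {i k} → i ≢ k → P (g (i , j)) (g (k , j))
    row j = triangle {λ i → g (i , j)} (rows j)

    col : ∀ i {j l} → j ≢ l → P (g (i , j)) (g (i , l))
    col i = triangle {λ j → g (i , j)} (cols i)

    move : ∀ {i k k′ j l} → j ≢ l → i ≢ k → i ≢ k′ →
           N (g (i , j)) (g (k , l)) → N (g (i , j)) (g (k′ , l))
    move {i} {k} {k′} {j} {l} j≢l i≢k i≢k′ e with k Fin.≟ k′
    ... | yes refl = e
    -- The point `g (i , l)`, where column i meets row l, takes the part of v in `far`.
    ... | no  k≢k′ = far (col i (≢-sym j≢l)) (row l i≢k) (row l i≢k′) (row l k≢k′) e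

    moveᵀ : ∀ {i k j l l′} → i ≢ k → j ≢ l → j ≢ l′ →
            N (g (i , j)) (g (k , l)) → N (g (i , j)) (g (k , l′))
    moveᵀ {i} {k} {j} {l} {l′} i≢k j≢l j≢l′ e with l Fin.≟ l′
    ... | yes refl = e
    ... | no  l≢l′ = far (row j (≢-sym i≢k)) (col k j≢l) (col k j≢l′) (col k l≢l′) e

    all-skew : ∀ {i k j l} → i ≢ k → j ≢ l → N (g (i , j)) (g (k , l))
    -- The inner `slide` moves the first coordinates with the second ones held at 0 and 1, and the
    -- outer one then moves the second coordinates. `E-sym` exchanges the ends so that either can
    -- move.
    all-skew {i} {k} i≢k = slide {λ j l → N (g (i , j)) (g (k , l))}
      (moveᵀ i≢k) (λ j≢l j′≢l e → E-sym (moveᵀ (≢-sym i≢k) (≢-sym j≢l) (≢-sym j′≢l) (E-sym e)))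
      (slide {λ i k → N (g (i , 0F)) (g (k , 1F))}
        (move λ ()) (λ i≢k i′≢k e → E-sym (move (λ ()) (≢-sym i≢k) (≢-sym i′≢k) (E-sym e)))
        skew i≢k)

    aligned⇒P : ∀ x y → x ≢ y → proj₁ x ≡ proj₁ y ⊎ proj₂ x ≡ proj₂ y → P (g x) (g y)
    aligned⇒P (i , j) (i , l) x≢y (inj₁ refl) = col i λ { refl → x≢y refl }
    aligned⇒P (i , j) (k , j) x≢y (inj₂ refl) = row j λ { refl → x≢y refl }

    skew⇒N : ∀ x y → proj₁ x ≢ proj₁ y × proj₂ x ≢ proj₂ y → N (g x) (g y)
    skew⇒N _ _ (i≢k , j≢l) = all-skew i≢k j≢l

    nonsquare⇒N : ∀ x y → NonSquareDifference x y → N (g x) (g y)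
    nonsquare⇒N x y ns = skew⇒N x y (nonsquare⇒skew x y ns)

    square⇒P : ∀ x y → x ≢ y → ¬ NonSquareDifference x y → P (g x) (g y)
    square⇒P x y x≢y ¬ns =
      aligned⇒P x y x≢y (square⇒aligned x y (decidable-stable (square? (y -₉ x)) ¬ns))

    N⇒nonsquare : ∀ x y → N (g x) (g y) → NonSquareDifference x y
    N⇒nonsquare x y n sq =
      E-disjoint (aligned⇒P x y (λ { refl → E-irrefl n }) (square⇒aligned x y sq)) n

    P⇒square : ∀ x y → P (g x) (g y) → ¬ NonSquareDifference x y
    P⇒square x y p ns = E-disjoint p (nonsquare⇒N x y ns)

    g-injective : ∀ {x y} → g x ≡ g y → x ≡ y
    g-injective {x@(i , j)} {y@(k , l)} e with i Fin.≟ k | j Fin.≟ l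
    ... | yes refl | yes refl = refl
    ... | yes refl | no j≢l   = contradiction e (distinct (col i j≢l))
    ... | no i≢k   | yes refl = contradiction e (distinct (row j i≢k))
    ... | no i≢k   | no j≢l   = contradiction e (distinct (all-skew i≢k j≢l))

    g-surjective : ∀ z → ∃[ x ] g x ≡ z
    g-surjective z with injective⇒surjective
      {f = λ i → g (Inverse.to (Fin.*↔× {3} {3}) i)}
      (λ e → Injection.injective (↔⇒↣ (Fin.*↔× {3} {3})) (g-injective e)) z
    ... | i , e = _ , e

-- Transport to the given graph and the isomorphism

open SignifiedGraph using (Vertex; Negative; Positive)

module _ (H : SignifiedGraph) (finite₉ : Vertex H ↔ Fin 9)
         (universal : (G : SignifiedGraph) → Outerplanar (SignifiedGraph.graph G) → Hom G H) where

  private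
    module H = SignifiedGraph H
    open Inverse finite₉ using () renaming (to to index; from to vertex)

    vertex-index : ∀ u → vertex (index u) ≡ u
    vertex-index = Inverse.strictlyInverseʳ finite₉

    index-vertex : ∀ i → index (vertex i) ≡ i
    index-vertex = Inverse.strictlyInverseˡ finite₉

    Edge : Sign → H.Vertex → H.Vertex → Set
    Edge Sign.+ = H.Positive
    Edge Sign.- = H.Negative

    -- Wrapped in a record because `Edge s` computes by cases on s; from `E s i j` the sign and both
    -- ends can be inferred.
    record E (s : Sign) (i j : Fin 9) : Set where
      constructor edge
      field
        vertex-edge : Edge s (vertex i) (vertex j)

    open E

    E? : ∀ s → Decidable (E s)
    E? s i j = map′ edge vertex-edge (Edge? s)
      where
      Edge? : ∀ s → Dec (Edge s (vertex i) (vertex j))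
      Edge? Sign.+ = H.adj? (vertex i) (vertex j) ×-dec ¬? (H.negative? (vertex i) (vertex j))
      Edge? Sign.- = H.negative? (vertex i) (vertex j)

    E-sym : ∀ {s i j} → E s i j → E s j i
    E-sym {Sign.+} (edge (adj , ¬neg)) = edge (H.symm adj , λ neg → ¬neg (H.neg-symm neg))
    E-sym {Sign.-} (edge neg)          = edge (H.neg-symm neg)

    E-irrefl : ∀ {s i} → ¬ E s i i
    E-irrefl {Sign.+} (edge (adj , _)) = H.irrefl refl adj
    E-irrefl {Sign.-} (edge neg)       = H.irrefl refl (H.neg⇒adj neg)

    E-disjoint : ∀ {i j} → E Sign.+ i j → ¬ E Sign.- i j
    E-disjoint (edge (_ , ¬neg)) (edge neg) = ¬neg neg

    Edge⇒E : ∀ s {u v} → Edge s u v → E s (index u) (index v)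
    Edge⇒E s {u} {v} e = edge (subst₂ (Edge s) (sym (vertex-index u)) (sym (vertex-index v)) e)

    open Signed Fin._≟_ E E? E-sym

    target : ∀ D → Target (allFin 9) D
    target D with universal (signifiedGraph D) (outerplanar D)
    ... | f , f-hom = record
      { map      = λ v → index (f v)
      ; map-edge = λ {u} {v} {s} → pres s u v
      ; map∈     = λ v → ∈-allFin (index (f v))
      }
      where
      open ChordDiagram D using (sign)
      pres : ∀ s u v → sign u v ≡ just s → E s (index (f u)) (index (f v))
      pres Sign.+ u v e = Edge⇒E Sign.+ (IsHom.pres-positive f-hom
        ((Sign.+ , e) , λ e′ → case trans (sym e) e′ of λ ()))
      pres Sign.- u v e = Edge⇒E Sign.- (IsHom.pres-negative f-hom e)

    open Gridding E E? E-sym E-irrefl E-disjoint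
      (Nine.tight E E? E-sym E-irrefl E-disjoint (stable-core 9 (allFin 9) ℕ.≤-refl target))

  module FromGrid (G : Grid) where
    open GridProperties G
    open Grid G using (g)

    coordinates : H.Vertex → 𝔽₉
    coordinates u = proj₁ (g-surjective (index u))

    g-coordinates : ∀ u → g (coordinates u) ≡ index u
    g-coordinates u = proj₂ (g-surjective (index u))

    bijection : H.Vertex ↔ 𝔽₉
    bijection = mk↔ₛ′ coordinates (λ x → vertex (g x))
      (λ x → g-injective (trans (g-coordinates (vertex (g x))) (index-vertex (g x))))
      (λ u → trans (cong vertex (g-coordinates u)) (vertex-index u))

    edge-coordinates : ∀ s {u v} → Edge s u v → E s (g (coordinates u)) (g (coordinates v))
    edge-coordinates s {u} {v} e =
      subst₂ (E s) (sym (g-coordinates u)) (sym (g-coordinates v)) (Edge⇒E s e)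

    iso : Iso H SP₉
    iso = record
      { bijection = bijection
      ; to-hom = record
        { pres-negative = λ e → N⇒nonsquare _ _ (edge-coordinates Sign.- e)
        ; pres-positive = λ e → let p = edge-coordinates Sign.+ e in
            (λ x≡y → distinct p (cong g x≡y)) , P⇒square _ _ p
        }
      ; from-hom = record
        { pres-negative = λ ns → vertex-edge (nonsquare⇒N _ _ ns)
        ; pres-positive = λ (x≢y , ¬ns) → vertex-edge (square⇒P _ _ x≢y ¬ns)
        }
      }

  iso : Iso H SP₉
  iso = FromGrid.iso grid

mainTheorem14 : (H : SignifiedGraph) → SignifiedGraph.order H ≡ 9 →
    ((G : SignifiedGraph) → Outerplanar (SignifiedGraph.graph G) → Hom G H) →
    Iso H SP₉
mainTheorem14 H order≡9 = iso H (subst (λ n → Vertex H ↔ Fin n) order≡9 (SignifiedGraph.finite H))
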